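{- Let $d \in \mathbb{N}$, $d \ge 1$. There exists an online edge-coloring algorithm in the advice-with-request model which receives $1+\lceil \log_2 (2d)\rceil+\lceil \log_2 (d+1)\rceil$ bits of advice with each edge, and which, for every $d$-degenerate input graph $G$ (with any order of arrival of its edges), produces an optimal edge coloring, i.e., a proper edge coloring of $G$ using exactly $\chi'(G)$ colors. In particular it uses $O(m\log d)$ advice bits in total, where $m$ is the number of edges.
   Context: All graphs are simple. An edge coloring assigns colors (positive integers) to edges so that no two edges sharing an endpoint get the same color; $\chi'(G)$ is the least number of colors in an edge coloring of $G$. A graph is $d$-degenerate if its vertices can be ordered $v_1,\dots,v_n$ so that each $v_i$ is adjacent to at most $d$ vertices among $v_1,\dots,v_{i-1}$. Online edge coloring: the edges $e_1,\dots,e_m$ of an unknown graph arrive one at a time, each specified by its endpoints (vertices are not known in advance); each edge must be irrevocably assigned a color before the next edge arrives, keeping the coloring proper; the goal is to use few colors. Advice-with-request model: an oracle that knows the whole input supplies, together with each edge $e_i$, a bit string $b_i\in\{0,1\}^b$ for a fixed $b$; the color of $e_i$ may depend only on $e_1,\dots,e_i$ and $b_1,\dots,b_i$. The value $d$ is known to both algorithm and oracle. -}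

module Defs where

open import Data.Nat using (ℕ; suc; _+_; _*_; _≤_; _≟_)
open import Data.Nat.Logarithm using (⌈log₂_⌉)
open import Data.Bool using (Bool)
open import Data.List using (List; []; _∷_; length; lookup; take; filter; tabulate; deduplicate)
open import Data.List.Membership.Propositional using (_∈_)
open import Data.List.Relation.Unary.Any using (Any; any?)
open import Data.List.Relation.Unary.All using (All)
open import Data.List.Relation.Unary.Unique.Propositional using (Unique)
open import Data.Vec using (Vec)
open import Data.Fin using (Fin; toℕ)
open import Data.Product using (_×_; _,_; proj₁; proj₂; ∃; Σ)
open import Data.Product.Properties using () renaming (≡-dec to ×-≡-dec)
open import Data.Sum using (_⊎_)
open import Relation.Nullary using (Dec; ¬_)
open import Relation.Nullary.Decidable using (_×-dec_; _⊎-dec_)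
open import Relation.Binary.PropositionalEquality using (_≡_; _≢_)

-- Vertices are natural numbers (not known in advance); an edge is given by its two endpoints.
Vertex : Set
Vertex = ℕ

Edge : Set
Edge = Vertex × Vertex

endpoints : Edge → List Vertex
endpoints (u , v) = u ∷ v ∷ []

SameEdge : Edge → Edge → Set
SameEdge (u , v) (x , y) = (u ≡ x × v ≡ y) ⊎ (u ≡ y × v ≡ x)

sameEdge? : (e f : Edge) → Dec (SameEdge e f)
sameEdge? (u , v) (x , y) = ((u ≟ x) ×-dec (v ≟ y)) ⊎-dec ((u ≟ y) ×-dec (v ≟ x))

IsSimple : List Edge → Set
IsSimple es =
  (∀ i → proj₁ (lookup es i) ≢ proj₂ (lookup es i)) ×
  (∀ i j → SameEdge (lookup es i) (lookup es j) → i ≡ j)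

Adj : List Edge → Vertex → Vertex → Set
Adj es u v = Any (λ e → SameEdge e (u , v)) es

adj? : (es : List Edge) (u v : Vertex) → Dec (Adj es u v)
adj? es u v = any? (λ e → sameEdge? e (u , v)) es

Degenerate : ℕ → List Edge → Set
Degenerate d es =
  Σ (List Vertex) λ vs →
    Unique vs ×
    (∀ e → e ∈ es → All (_∈ vs) (endpoints e)) ×
    (∀ k → length (filter (λ u → adj? es u (lookup vs k)) (take (toℕ k) vs)) ≤ d)

ShareEndpoint : Edge → Edge → Set
ShareEndpoint e f = ∃ λ x → x ∈ endpoints e × x ∈ endpoints f

ProperColoring : (es : List Edge) → (Fin (length es) → ℕ) → Set
ProperColoring es c =
  ∀ i j → i ≢ j → ShareEndpoint (lookup es i) (lookup es j) → c i ≢ c j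

numColors : (es : List Edge) → (Fin (length es) → ℕ) → ℕ
numColors es c = length (deduplicate _≟_ (tabulate c))

IsChromaticIndex : List Edge → ℕ → Set
IsChromaticIndex es k =
  (∃ λ c → ProperColoring es c × numColors es c ≡ k) ×
  (∀ c → ProperColoring es c → k ≤ numColors es c)

-- An online algorithm with b bits of advice per edge: the colour of e_i is a
-- function of the prefix e_1..e_i and the advice prefix b_1..b_i.
OnlineAlgorithm : ℕ → Set
OnlineAlgorithm b = List Edge → List (Vec Bool b) → ℕ

run : ∀ {b} → OnlineAlgorithm b → (es : List Edge) → List (Vec Bool b) → Fin (length es) → ℕ
run A es bs i = A (take (suc (toℕ i)) es) (take (suc (toℕ i)) bs)

adviceBits : ℕ → ℕ
adviceBits d = 1 + ⌈log₂ (2 * d) ⌉ + ⌈log₂ (d + 1) ⌉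

{-# OPTIONS --safe #-}
module Submission where

-- Order the vertices so that each has at most d earlier neighbours, its parents.
--
-- If 2d ≤ k, a graph of maximum degree ≤ k is k-edge-colourable: insert the edges by
-- increasing parent. When vw is inserted, w is joined only to its parents, so counting
-- colours gives some α missing at w that is missing at v or leads from v to a child x; in the
-- latter case some γ is missing at both w and x, as neither has neighbours besides its parents.
-- With β missing at v, the γ/β-chain of v avoids w or x; it is swapped, and vw receives γ, or
-- vw receives α and vx receives γ.
--
-- Now let b = 2d (b = 1 if d = 1) and χ′ = qb + r with r < b. In an optimal colouring, the
-- edges of the first r colours keep their colours ("extra" edges); the others form a graph
-- of maximum degree ≤ qb, which is split into q classes of maximum degree ≤ b, each with
-- its own block of b colours. Every vertex u hands out positions in ℕ to its edges, class =
-- position / b. The at most d edges to parents occupy fixed positions, and edges to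
-- children take the free positions in order of arrival, so the position of a child edge
-- differs by at most d ≤ b from the number of child edges of u seen before. One bit thus
-- suffices to communicate the class, besides one bit each for "extra" and for the parent,
-- and the colour in the block.

open import Defs
open import Data.Bool as Bool using (Bool; true; false; if_then_else_; not)
open import Data.Fin as Fin using (Fin; zero; suc; toℕ; fromℕ<; join; _↑ˡ_; _↑ʳ_)
import Data.Fin.Properties as Fin
open import Data.Fin.Permutation.Components using (transpose)
open import Data.List using (List; []; _∷_; _++_; map; zip; upTo; allFin; tabulate; filter; length; take; reverse; lookup; deduplicate)
import Data.List.Properties as List
import Data.List.Membership.DecPropositional as DecMembership
open import Data.List.Membership.Propositional using (_∈_; find; lose)
open import Data.List.Membership.Propositional.Properties
open import Data.List.Relation.Binary.Permutation.Propositional.Properties using (↭-reverse; filter-↭; ↭-length)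
open import Data.List.Relation.Unary.All as All using (All; []; _∷_)
open import Data.List.Relation.Unary.AllPairs using ([]; _∷_)
open import Data.List.Relation.Unary.Any using (here; there; index; any?)
open import Data.List.Relation.Unary.Any.Properties using (lookup-index)
open import Data.List.Relation.Unary.Unique.Propositional using (Unique)
import Data.List.Relation.Unary.Unique.Propositional.Properties as Unique
open import Data.List.Relation.Unary.Unique.DecPropositional.Properties using (deduplicate-!)
open import Data.Nat as ℕ using (ℕ; zero; suc; _+_; _*_; _∸_; _^_; _≤_; _<_; z≤n; s≤s; s<s⁻¹; z<s; s<s; NonZero; ⌈_/2⌉; ⌊_/2⌋)
open import Data.Nat.DivMod using (_/_; _%_; m≡m%n+[m/n]*n; /-monoˡ-≤; n/n≡1; +-distrib-/-∣ʳ; m<n*o⇒m/o<n; m%n<n; [m+kn]%n≡m%n; m<n⇒m%n≡m)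
open import Data.Nat.Divisibility using (∣-refl)
open import Data.Nat.Induction using (<-rec)
open import Data.Nat.Logarithm using (⌈log₂_⌉; ⌈log₂⌉-mono-≤; ⌈log₂⌈n/2⌉⌉≡⌈log₂n⌉∸1)
import Data.Nat.Properties as ℕ
open import Data.Product using (_×_; _,_; proj₁; proj₂; ∃; Σ)
open import Data.Sum as Sum using (_⊎_; inj₁; inj₂)
open import Data.Sum.Properties using (inj₁-injective; inj₂-injective)
open import Data.Vec as Vec using (Vec; []; _∷_)
import Data.Vec.Properties as Vec
open import Function using (_∘_; id)
open import Relation.Binary.Definitions using (tri<; tri≈; tri>)
open import Relation.Binary.PropositionalEquality
open import Relation.Nullary using (Dec; yes; no; ¬_; contradiction)
open import Relation.Nullary.Decidable using (_×-dec_; _→-dec_; ¬?; map′; dec-true; dec-false)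
open import Relation.Unary using (Decidable)

-- Two-coloured chains as alternating walks.

least : ∀ {P : ℕ → Set} → Decidable P → ∀ {k} → P k →
        ∃ λ m → P m × (∀ {i} → i < m → ¬ P i)
least P? {k} Pk with P? 0
... | yes P0 = 0 , P0 , λ ()
least P? {zero}  Pk | no ¬P0 = contradiction Pk ¬P0
least {P} P? {suc k} Pk | no ¬P0 with m , Pm , min ← least (P? ∘ suc) Pk =
  suc m , Pm , below
  where
  below : ∀ {i} → i < suc m → ¬ P i
  below {zero}  _   = ¬P0
  below {suc i} i<m = min (s<s⁻¹ i<m)

-- a and b are two colour classes, a fixed point being a vertex that misses
-- the colour.  The walk v, a v, b (a v), … can only return to a state it has
-- visited by retracing itself back to v, so it reaches a fixed point; the
-- vertices up to the first one form the a/b-component of v.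
module AlternatingWalk {n} (a b : Fin n → Fin n)
  (a-inv : ∀ u → a (a u) ≡ u) (b-inv : ∀ u → b (b u) ≡ u)
  (v : Fin n) (bv≡v : b v ≡ v) where

  -- The flag records which involution is applied next, so that the state alone determines how the
  -- walk continues.
  State : Set
  State = Fin n × Bool

  next prev : State → State
  next (u , false) = a u , true
  next (u , true)  = b u , false
  prev (u , false) = b u , true
  prev (u , true)  = a u , false

  prev-next : ∀ s → prev (next s) ≡ s
  prev-next (u , false) = cong (_, false) (a-inv u)
  prev-next (u , true)  = cong (_, true) (b-inv u)

  walk : ℕ → State
  walk zero    = v , false
  walk (suc i) = next (walk i)

  Stuck : ℕ → Set
  Stuck i = proj₁ (walk (suc i)) ≡ proj₁ (walk i)

  code : State → Fin (n + n)
  code (u , false) = u ↑ˡ n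
  code (u , true)  = n ↑ʳ u

  code-injective : ∀ s t → code s ≡ code t → s ≡ t
  code-injective (u , false) (x , false) eq = cong (_, false) (Fin.↑ˡ-injective n u x eq)
  code-injective (u , true)  (x , true)  eq = cong (_, true) (Fin.↑ʳ-injective n u x eq)
  code-injective (u , false) (x , true)  eq
    with () ← trans (sym (Fin.splitAt-↑ˡ n u n)) (trans (cong (Fin.splitAt n) eq) (Fin.splitAt-↑ʳ n n x))
  code-injective (u , true)  (x , false) eq
    with () ← trans (sym (Fin.splitAt-↑ʳ n n u)) (trans (cong (Fin.splitAt n) eq) (Fin.splitAt-↑ˡ n x n))

  prev-walk : ∀ i → prev (walk (suc i)) ≡ walk i
  prev-walk i = prev-next (walk i)

  -- Since `prev` undoes `next`, a repetition can be shifted back until it involves time 0. A return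
  -- to `(v , false)` is preceded by `(b v , true)`, whose vertex is `v` again, so the walk stood
  -- still in that step.
  repeat⇒stuck : ∀ i j → i < j → walk i ≡ walk j → ∃ Stuck
  repeat⇒stuck zero (suc j) _ eq = j , (begin
    proj₁ (walk (suc j))  ≡⟨ cong proj₁ eq ⟨
    v                     ≡⟨ bv≡v ⟨
    proj₁ (prev (walk 0)) ≡⟨ cong (proj₁ ∘ prev) eq ⟩
    proj₁ (prev (walk (suc j))) ≡⟨ cong proj₁ (prev-walk j) ⟩
    proj₁ (walk j) ∎)
    where open ≡-Reasoning
  repeat⇒stuck (suc i) (suc j) i<j eq = repeat⇒stuck i j (s<s⁻¹ i<j)
    (trans (sym (prev-walk i)) (trans (cong prev eq) (prev-walk j)))

  ∃stuck : ∃ Stuck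
  ∃stuck with i , j , i<j , eq ← Fin.pigeonhole (ℕ.n<1+n (n + n)) (code ∘ walk ∘ toℕ) =
    repeat⇒stuck (toℕ i) (toℕ j) i<j (code-injective (walk (toℕ i)) (walk (toℕ j)) eq)

  abstract
    end : ∃ λ m → Stuck m × (∀ {i} → i < m → ¬ Stuck i)
    end = least (λ i → proj₁ (walk (suc i)) Fin.≟ proj₁ (walk i)) {proj₁ ∃stuck} (proj₂ ∃stuck)

  m : ℕ
  m = proj₁ end

  Component : Fin n → Set
  Component u = ∃ λ i → i < suc m × proj₁ (walk i) ≡ u

  component? : Decidable Component
  component? u = ℕ.anyUpTo? (λ i → proj₁ (walk i) Fin.≟ u) (suc m)

  start : Component v
  start = 0 , z<s , refl

  next-closed : ∀ {i} → i < suc m → Component (proj₁ (next (walk i)))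
  next-closed {i} i<1+m with ℕ.m≤n⇒m<n∨m≡n (ℕ.≤-pred i<1+m)
  ... | inj₁ i<m  = suc i , s<s i<m , refl
  ... | inj₂ refl = m , i<1+m , sym (proj₁ (proj₂ end))

  prev-closed : ∀ {i} → i < suc m → Component (proj₁ (prev (walk i)))
  prev-closed {zero}  _     = 0 , z<s , sym bv≡v
  prev-closed {suc i} i<1+m = i , ℕ.<-trans (ℕ.n<1+n i) i<1+m , sym (cong proj₁ (prev-walk i))

  -- At a visited state one of `a` and `b` is the next step and the other the previous one. Neither
  -- direction leaves the component: the walk stands still at time `m`, and going back from time 0
  -- applies `b`, which fixes `v`.
  closedᵃ : ∀ {u} → Component u → Component (a u)
  closedᵃ (i , i<1+m , refl) with walk i | next-closed i<1+m | prev-closed i<1+m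
  ... | u , false | s | _ = s
  ... | u , true  | _ | p = p

  closedᵇ : ∀ {u} → Component u → Component (b u)
  closedᵇ (i , i<1+m , refl) with walk i | next-closed i<1+m | prev-closed i<1+m
  ... | u , false | _ | p = p
  ... | u , true  | s | _ = s

  -- If `a` is the next step at `u`, the walk is stuck there, and no time before `m` is stuck. If
  -- `a` was the previous step, the walk was stuck one step earlier, hence before `m`, which is
  -- impossible.
  free⇒end : ∀ {u} → Component u → a u ≡ u → u ≡ proj₁ (walk m)
  free⇒end {u} (i , i<1+m , eq) au≡u = cong proj₁ (sym (at i i<1+m (walk i) refl eq))
    where
    at : ∀ i → i < suc m → ∀ s → walk i ≡ s → proj₁ s ≡ u → walk m ≡ (u , proj₂ (walk m))
    at i i<1+m (u , false) wi refl with ℕ.m≤n⇒m<n∨m≡n (ℕ.≤-pred i<1+m)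
    ... | inj₁ i<m  = contradiction (trans (cong (proj₁ ∘ next) wi) (trans au≡u (sym (cong proj₁ wi))))
                                    (proj₂ (proj₂ end) i<m)
    ... | inj₂ refl = cong (_, proj₂ (walk m)) (cong proj₁ wi)
    at (suc i) i<1+m (u , true) wi refl =
      contradiction (trans (cong proj₁ wi) (sym wi′)) (proj₂ (proj₂ end) (ℕ.≤-pred i<1+m))
      where
      wi′ : proj₁ (walk i) ≡ u
      wi′ = trans (cong proj₁ (trans (sym (prev-walk i)) (cong prev wi))) au≡u

  avoids : ∀ {w x} → w ≢ x → a w ≡ w → a x ≡ x → ¬ Component w ⊎ ¬ Component x
  avoids {w} w≢x aw ax with component? w
  ... | no  w∉ = inj₁ w∉
  ... | yes w∈ = inj₂ λ x∈ → w≢x (trans (free⇒end w∈ aw) (sym (free⇒end x∈ ax)))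

-- Partial edge colourings and how to modify them.

link : ∀ {n} → Fin n → Fin n → (Fin n → Fin n) → Fin n → Fin n
link v w f u with u Fin.≟ v | u Fin.≟ w
... | yes _ | _     = w
... | no _  | yes _ = v
... | no _  | no _  = f u

-- Involutions are read as matchings, with fixed points for unmatched vertices: `link` adds the edge
-- `v w`, and `cut` deletes the edge `v x`.
cut : ∀ {n} → Fin n → Fin n → (Fin n → Fin n) → Fin n → Fin n
cut v x f u with u Fin.≟ v | u Fin.≟ x
... | no _ | no _ = f u
... | _    | _    = u

module _ {n} {v w : Fin n} {f : Fin n → Fin n} where

  link-≡ˡ : link v w f v ≡ w
  link-≡ˡ with v Fin.≟ v
  ... | yes _  = refl
  ... | no v≢v = contradiction refl v≢v

  link-≡ʳ : link v w f w ≡ v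
  link-≡ʳ with w Fin.≟ v | w Fin.≟ w
  ... | yes w≡v | _       = w≡v
  ... | no _    | yes _   = refl
  ... | no _    | no w≢w  = contradiction refl w≢w

  link-≢ : ∀ {u} → u ≢ v → u ≢ w → link v w f u ≡ f u
  link-≢ {u} u≢v u≢w with u Fin.≟ v | u Fin.≟ w
  ... | yes u≡v | _       = contradiction u≡v u≢v
  ... | no _    | yes u≡w = contradiction u≡w u≢w
  ... | no _    | no _    = refl

  link-involutive : (∀ u → f (f u) ≡ u) → f v ≡ v → f w ≡ w → ∀ u → link v w f (link v w f u) ≡ u
  link-involutive inv fv fw u with u Fin.≟ v | u Fin.≟ w
  ... | yes refl | _        = link-≡ʳ
  ... | no _     | yes refl = link-≡ˡ
  ... | no u≢v   | no u≢w   = trans (link-≢ (λ e → u≢v (back e fv)) (λ e → u≢w (back e fw))) (inv u)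
    where
    back : ∀ {y} → f u ≡ y → f y ≡ y → u ≡ y
    back fu fy = trans (sym (inv u)) (trans (cong f fu) fy)

  cut-≡ˡ : cut v w f v ≡ v
  cut-≡ˡ with v Fin.≟ v
  ... | yes _  = refl
  ... | no v≢v = contradiction refl v≢v

  cut-≡ʳ : cut v w f w ≡ w
  cut-≡ʳ with w Fin.≟ v | w Fin.≟ w
  ... | yes _ | _      = refl
  ... | no _  | yes _  = refl
  ... | no _  | no w≢w = contradiction refl w≢w

  cut-≢ : ∀ {u} → u ≢ v → u ≢ w → cut v w f u ≡ f u
  cut-≢ {u} u≢v u≢w with u Fin.≟ v | u Fin.≟ w
  ... | yes u≡v | _       = contradiction u≡v u≢v
  ... | no _    | yes u≡w = contradiction u≡w u≢w
  ... | no _    | no _    = refl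

  cut-fixed : ∀ {u} → f u ≡ u → cut v w f u ≡ u
  cut-fixed {u} fu with u Fin.≟ v | u Fin.≟ w
  ... | yes _ | yes _ = refl
  ... | yes _ | no _  = refl
  ... | no _  | yes _ = refl
  ... | no _  | no _  = fu

  cut-moved : ∀ {u} → cut v w f u ≢ u → cut v w f u ≡ f u × u ≢ v × u ≢ w
  cut-moved {u} ne with u Fin.≟ v | u Fin.≟ w
  ... | yes _ | yes _ = contradiction refl ne
  ... | yes _ | no _  = contradiction refl ne
  ... | no _  | yes _ = contradiction refl ne
  ... | no p  | no q  = refl , p , q

  cut-involutive : (∀ u → f (f u) ≡ u) → f v ≡ w → ∀ u → cut v w f (cut v w f u) ≡ u
  cut-involutive inv fv u with u Fin.≟ v | u Fin.≟ w
  ... | yes refl | yes _    = cut-≡ˡ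
  ... | yes refl | no _     = cut-≡ˡ
  ... | no _     | yes refl = cut-≡ʳ
  ... | no u≢v   | no u≢w   = trans
    (cut-≢ (λ e → u≢w (trans (sym (inv u)) (trans (cong f e) fv)))
           (λ e → u≢v (trans (sym (inv u)) (trans (cong f (trans e (sym fv))) (inv v)))))
    (inv u)

-- A partial edge colouring is stored as one involution per colour: the mate
-- of u in colour c is the other end of its c-edge, or u itself if u misses c.
record Colouring (n k : ℕ) (R : Fin n → Fin n → Set) : Set where
  field
    mate       : Fin k → Fin n → Fin n
    involutive : ∀ c u → mate c (mate c u) ≡ u
    unique     : ∀ {c c′ u} → mate c u ≢ u → mate c u ≡ mate c′ u → c ≡ c′
    sound      : ∀ {c u} → mate c u ≢ u → R u (mate c u)

  Coloured : Fin n → Fin n → Set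
  Coloured u x = ∃ λ c → mate c u ≡ x

open Colouring

-- A whole colour class is exchanged at once; `f-new` keeps an edge of the new class from having a
-- second colour.
module Replace {n k : ℕ} {R : Fin n → Fin n → Set} (M : Colouring n k R) (α : Fin k) (f : Fin n → Fin n)
  (f-inv : ∀ u → f (f u) ≡ u)
  (f-sound : ∀ {u} → f u ≢ u → R u (f u))
  (f-new : ∀ {u c} → c ≢ α → f u ≢ u → mate M c u ≢ f u) where

  private
    mate′ : Fin k → Fin n → Fin n
    mate′ c with c Fin.≟ α
    ... | yes _ = f
    ... | no _  = mate M c

    inv′ : ∀ c u → mate′ c (mate′ c u) ≡ u
    inv′ c with c Fin.≟ α
    ... | yes _ = f-inv
    ... | no _  = involutive M c

    uniq′ : ∀ {c c′ u} → mate′ c u ≢ u → mate′ c u ≡ mate′ c′ u → c ≡ c′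
    uniq′ {c} {c′} ne eq with c Fin.≟ α | c′ Fin.≟ α
    ... | yes c≡α | yes c′≡α = trans c≡α (sym c′≡α)
    ... | yes _   | no c′≢α  = contradiction (sym eq) (f-new c′≢α ne)
    ... | no c≢α  | yes _    = contradiction eq (f-new c≢α (ne ∘ trans eq))
    ... | no _    | no _     = unique M ne eq

    sound′ : ∀ {c u} → mate′ c u ≢ u → R u (mate′ c u)
    sound′ {c} with c Fin.≟ α
    ... | yes _ = f-sound
    ... | no _  = sound M

  abstract
    replace : Colouring n k R
    replace = record { mate = mate′ ; involutive = inv′ ; unique = λ {c} {c′} → uniq′ {c} {c′} ; sound = λ {c} → sound′ {c} }

    replace-≡ : ∀ u → mate replace α u ≡ f u
    replace-≡ u with α Fin.≟ α
    ... | yes _  = refl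
    ... | no α≢α = contradiction refl α≢α

    replace-≢ : ∀ {c} → c ≢ α → ∀ u → mate replace c u ≡ mate M c u
    replace-≢ {c} c≢α u with c Fin.≟ α
    ... | yes c≡α = contradiction c≡α c≢α
    ... | no _    = refl

infix 4 _⊑_
-- Recolouring is allowed, and an edge only has to remain coloured. The condition `u ≢ x` leaves out
-- fixed points, which stand for missing colours and not for edges.
_⊑_ : ∀ {n k R} → Colouring n k R → Colouring n k R → Set
M ⊑ M′ = ∀ {u x} → u ≢ x → Coloured M u x → Coloured M′ u x

module _ {n k : ℕ} {R : Fin n → Fin n → Set} (M : Colouring n k R) where

  mate-sym : ∀ {c u x} → mate M c u ≡ x → mate M c x ≡ u
  mate-sym {c} {u} eq = trans (cong (mate M c) (sym eq)) (involutive M c u)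

  -- Recolours vw with α, where f is what is to remain of the class α: all of
  -- it, or all of it except for the edge at v.
  module Recolour (α : Fin k) (f : Fin n → Fin n) {v w : Fin n}
    (f-inv : ∀ u → f (f u) ≡ u) (f⊆α : ∀ {u} → f u ≢ u → f u ≡ mate M α u)
    (fv : f v ≡ v) (fw : f w ≡ w)
    (Rvw : R v w) (Rwv : R w v) (vw∉ : ¬ Coloured M v w) where

    private
      moved : (P : Fin n → Fin n → Set) → P v w → P w v → (∀ {u} → f u ≢ u → P u (f u)) →
              ∀ {u} → link v w f u ≢ u → P u (link v w f u)
      moved P Pvw Pwv Pf {u} ne with u Fin.≟ v | u Fin.≟ w
      ... | yes refl | _        = Pvw
      ... | no _     | yes refl = Pwv
      ... | no _     | no _     = Pf ne

    open Replace M α (link v w f) (link-involutive f-inv fv fw)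
      (moved R Rvw Rwv λ {u} ne →
        subst (R u) (sym (f⊆α ne)) (sound M (λ e → ne (trans (f⊆α ne) e))))
      (λ {u} {c} c≢α → moved (λ u x → mate M c u ≢ x)
        (λ e → vw∉ (c , e)) (λ e → vw∉ (c , mate-sym e))
        (λ ne e → c≢α (sym (unique M (λ e′ → ne (trans (f⊆α ne) e′)) (trans (sym (f⊆α ne)) (sym e))))) {u})
      public renaming (replace to recolour; replace-≢ to recolour-≢)

    recolour-v : mate recolour α v ≡ w
    recolour-v = trans (replace-≡ v) (link-≡ˡ {v = v} {f = f})

    recolour-≡ : ∀ {u} → u ≢ v → u ≢ w → mate recolour α u ≡ f u
    recolour-≡ {u} u≢v u≢w = trans (replace-≡ u) (link-≢ u≢v u≢w)

    recolour-f : ∀ {u x} → u ≢ x → f u ≡ x → Coloured recolour u x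
    recolour-f {u} u≢x fu = α , trans (recolour-≡ (λ { refl → u≢x (trans (sym fv) fu) })
                                                  (λ { refl → u≢x (trans (sym fw) fu) })) fu

  add : ∀ {v w} α → mate M α v ≡ v → mate M α w ≡ w → R v w → R w v → ¬ Coloured M v w →
        ∃ λ M′ → M ⊑ M′ × Coloured M′ v w
  add {v} {w} α v∌α w∌α Rvw Rwv vw∉ = recolour , kept , α , recolour-v
    where
    open Recolour α (mate M α) (involutive M α) (λ _ → refl) v∌α w∌α Rvw Rwv vw∉
    kept : M ⊑ recolour
    kept {u} u≢x (c , eq) with c Fin.≟ α
    ... | yes refl = recolour-f u≢x eq
    ... | no c≢α   = c , trans (recolour-≢ c≢α u) eq

module _ {k : ℕ} (γ β : Fin k) where

  transpose-≡ˡ : transpose γ β γ ≡ β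
  transpose-≡ˡ rewrite dec-true (γ Fin.≟ γ) refl = refl

  transpose-≡ʳ : transpose γ β β ≡ γ
  transpose-≡ʳ with β Fin.≟ γ
  ... | yes β≡γ = β≡γ
  ... | no _ rewrite dec-true (β Fin.≟ β) refl = refl

  transpose-≢ : ∀ {c} → c ≢ γ → c ≢ β → transpose γ β c ≡ c
  transpose-≢ {c} c≢γ c≢β rewrite dec-false (c Fin.≟ γ) c≢γ | dec-false (c Fin.≟ β) c≢β = refl

  transpose-involutive : ∀ c → transpose γ β (transpose γ β c) ≡ c
  transpose-involutive c = cases (c Fin.≟ γ) (c Fin.≟ β)
    where
    cases : Dec (c ≡ γ) → Dec (c ≡ β) → transpose γ β (transpose γ β c) ≡ c
    cases (yes refl) _          = trans (cong (transpose γ β) transpose-≡ˡ) transpose-≡ʳ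
    cases (no _)     (yes refl) = trans (cong (transpose γ β) transpose-≡ʳ) transpose-≡ˡ
    cases (no c≢γ)   (no c≢β)   = trans (cong (transpose γ β) fixed) fixed
      where fixed = transpose-≢ c≢γ c≢β

-- Since `S` is closed under both mates, the two ends of a `γ`- or `β`-edge are both inside `S` or
-- both outside, so they agree on its new colour. Edges of other colours may leave `S`, as `τ` fixes
-- their colours.
module Flip {n k : ℕ} {R : Fin n → Fin n → Set} (M : Colouring n k R) (γ β : Fin k)
  {S : Fin n → Set} (S? : Decidable S)
  (γ-closed : ∀ {u} → S u → S (mate M γ u)) (β-closed : ∀ {u} → S u → S (mate M β u)) where

  private
    τ : Fin k → Fin k
    τ = transpose γ β

    ττ : ∀ c → τ (τ c) ≡ c
    ττ = transpose-involutive γ β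

    mate′ : Fin k → Fin n → Fin n
    mate′ c u with S? u
    ... | yes _ = mate M (τ c) u
    ... | no _  = mate M c u

    mate-∈ : ∀ {c u} → S u → mate′ c u ≡ mate M (τ c) u
    mate-∈ {c} {u} u∈ with S? u
    ... | yes _ = refl
    ... | no u∉ = contradiction u∈ u∉

    mate-∉ : ∀ {c u} → ¬ S u → mate′ c u ≡ mate M c u
    mate-∉ {c} {u} u∉ with S? u
    ... | yes u∈ = contradiction u∈ u∉
    ... | no _   = refl

    closed : ∀ c → (∀ {u} → S u → S (mate M c u)) ⊎ τ c ≡ c
    closed c = cases (c Fin.≟ γ) (c Fin.≟ β)
      where
      cases : Dec (c ≡ γ) → Dec (c ≡ β) → (∀ {u} → S u → S (mate M c u)) ⊎ τ c ≡ c
      cases (yes refl) _          = inj₁ γ-closed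
      cases (no _)     (yes refl) = inj₁ β-closed
      cases (no c≢γ)   (no c≢β)   = inj₂ (transpose-≢ γ β c≢γ c≢β)

    inv′ : ∀ c u → mate′ c (mate′ c u) ≡ u
    inv′ c u with S? u
    inv′ c u | yes u∈ with S? (mate M (τ c) u) | closed (τ c)
    ... | yes _ | _          = involutive M (τ c) u
    ... | no x∉ | inj₁ clos  = contradiction (clos u∈) x∉
    ... | no _  | inj₂ fixed = trans (cong (λ c′ → mate M c′ (mate M (τ c) u)) (trans (sym (ττ c)) fixed))
                                     (involutive M (τ c) u)
    inv′ c u | no u∉ with S? (mate M c u) | closed c
    ... | no _   | _          = involutive M c u
    ... | yes x∈ | inj₁ clos  = contradiction (subst S (involutive M c u) (clos x∈)) u∉
    ... | yes _  | inj₂ fixed = trans (cong (λ c′ → mate M c′ (mate M c u)) fixed) (involutive M c u)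

    uniq′ : ∀ {c c′ u} → mate′ c u ≢ u → mate′ c u ≡ mate′ c′ u → c ≡ c′
    uniq′ {c} {c′} {u} ne eq with S? u
    ... | yes _ = trans (sym (ττ c)) (trans (cong τ (unique M ne eq)) (ττ c′))
    ... | no _  = unique M ne eq

    sound′ : ∀ {c u} → mate′ c u ≢ u → R u (mate′ c u)
    sound′ {c} {u} ne with S? u
    ... | yes _ = sound M ne
    ... | no _  = sound M ne

  flip : Colouring n k R
  flip = record { mate = mate′ ; involutive = inv′ ; unique = λ {c} {c′} → uniq′ {c} {c′} ; sound = λ {c} → sound′ {c} }

  flip-⊒ : ∀ {u x} → Coloured M u x → Coloured flip u x
  flip-⊒ {u} (c , eq) with S? u
  ... | yes _ = τ c , trans (cong (λ c → mate M c u) (ττ c)) eq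
  ... | no _  = c , eq

  flip-⊑ : ∀ {u x} → Coloured flip u x → Coloured M u x
  flip-⊑ {u} (c , eq) with S? u
  ... | yes _ = τ c , eq
  ... | no _  = c , eq

  flip-∈ : ∀ {u} → S u → mate flip γ u ≡ mate M β u
  flip-∈ {u} u∈ = trans (mate-∈ u∈) (cong (λ c → mate M c u) (transpose-≡ˡ γ β))

  flip-∉ : ∀ {c u} → ¬ S u → mate flip c u ≡ mate M c u
  flip-∉ = mate-∉

-- Edge colouring of degenerate graphs by inserting edges.

module _ {n k : ℕ} {R : Fin n → Fin n → Set} where

  -- The flip makes `γ` missing at `v`, where `β` was missing, and does not affect `w` outside `S`.
  -- Hence `γ` becomes available for `v w`.
  add-flipped : (M : Colouring n k R) {v w : Fin n} (γ β : Fin k) {S : Fin n → Set} → Decidable S →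
    (∀ {u} → S u → S (mate M γ u)) → (∀ {u} → S u → S (mate M β u)) →
    S v → ¬ S w → mate M β v ≡ v → mate M γ w ≡ w → R v w → R w v → ¬ Coloured M v w →
    ∃ λ M′ → M ⊑ M′ × Coloured M′ v w
  add-flipped M γ β S? γ-closed β-closed v∈ w∉ v∌β w∌γ Rvw Rwv vw∉
    = proj₁ added , (λ u≢x → proj₁ (proj₂ added) u≢x ∘ flip-⊒) , proj₂ (proj₂ added)
    where
    open Flip M γ β S? γ-closed β-closed
    added = add flip γ (trans (flip-∈ v∈) v∌β) (trans (flip-∉ w∉) w∌γ) Rvw Rwv (vw∉ ∘ flip-⊑)

-- E p c says that p is a parent of c; the degree bounds d and k are given by
-- labels distinguishing the edges at a vertex.
module _ {n d k : ℕ} (2d≤k : d + d ≤ k)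
  {E : Fin n → Fin n → Set} (E? : ∀ p c → Dec (E p c)) (E⇒< : ∀ {p c} → E p c → p Fin.< c)
  (inLabel : ∀ {p c} → E p c → Fin d)
  (inLabel-injective : ∀ {p p′ c} (e : E p c) (e′ : E p′ c) → inLabel e ≡ inLabel e′ → p ≡ p′)
  (label : ∀ {u x} → E u x ⊎ E x u → Fin k)
  (label-injective : ∀ {u x y} (e : E u x ⊎ E x u) (f : E u y ⊎ E y u) → label e ≡ label f → x ≡ y)
  where

  UpTo : Fin n → Fin n → Fin n → Set
  UpTo v u x = (E u x × u Fin.≤ v) ⊎ (E x u × x Fin.≤ v)

  adjacent : ∀ {v u x} → UpTo v u x → E u x ⊎ E x u
  adjacent = Sum.map proj₁ proj₁

  -- As only edges from parents up to v are present, every vertex after v is joined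
  -- only to its at most d parents.
  module Insert {v w : Fin n} (M : Colouring n k (UpTo v)) (vw : E v w) (vw∉ : ¬ Coloured M v w) where

    Rvw : UpTo v v w
    Rvw = inj₁ (vw , ℕ.≤-refl)

    Rwv : UpTo v w v
    Rwv = inj₂ (vw , ℕ.≤-refl)

    later⇒parent : ∀ {c x} → v Fin.< x → mate M c x ≢ x → E (mate M c x) x
    later⇒parent v<x ne with sound M ne
    ... | inj₁ (_ , x≤v) = contradiction x≤v (ℕ.<⇒≱ v<x)
    ... | inj₂ (e , _)   = e

    -- If all `k` colours were present at `v`, their edges together with the uncoloured `v w` would
    -- have `k + 1` distinct labels in `Fin k`.
    missing : ∃ λ β → mate M β v ≡ v
    missing with Fin.any? (λ β → mate M β v Fin.≟ v)
    ... | yes found = found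
    ... | no  ¬miss = contradiction (Fin.injective⇒≤ f-inj) (ℕ.<⇒≱ (ℕ.n<1+n k))
      where
      moves : ∀ c → mate M c v ≢ v
      moves c = ¬miss ∘ (c ,_)
      f : Fin (suc k) → Fin k
      f zero    = label (adjacent Rvw)
      f (suc c) = label (adjacent (sound M (moves c)))
      f-inj : ∀ {i j} → f i ≡ f j → i ≡ j
      f-inj {zero}  {zero}  _  = refl
      f-inj {zero}  {suc j} eq = contradiction (j , sym (label-injective _ (adjacent (sound M (moves j))) eq)) vw∉
      f-inj {suc i} {zero}  eq = contradiction (i , label-injective (adjacent (sound M (moves i))) _ eq) vw∉
      f-inj {suc i} {suc j} eq = cong suc (unique M (moves i)
        (label-injective (adjacent (sound M (moves i))) (adjacent (sound M (moves j))) eq))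

    -- As vw is uncoloured, the edges to parents of w or of y use at most 2d − 1 colours.
    missing-avoiding : ∀ y → ∃ λ γ → mate M γ w ≡ w × ¬ E (mate M γ y) y
    missing-avoiding y with Fin.any? (λ γ → (mate M γ w Fin.≟ w) ×-dec ¬? (E? (mate M γ y) y))
    ... | yes found = found
    ... | no  ¬any  = contradiction (Fin.injective⇒≤ f-inj) (ℕ.<⇒≱ (s≤s 2d≤k))
      where
      data Used (c : Fin k) : Set where
        at-w : mate M c w ≢ w → E (mate M c w) w → Used c
        at-y : E (mate M c y) y → Used c
      used : ∀ c → Used c
      used c with mate M c w Fin.≟ w
      ... | no ne  = at-w ne (later⇒parent (E⇒< vw) ne)
      ... | yes eq with E? (mate M c y) y
      ...   | yes e = at-y e
      ...   | no ¬e = contradiction (c , eq , ¬e) ¬any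
      slot : ∀ {c} → Used c → Fin d ⊎ Fin d
      slot (at-w _ e) = inj₁ (inLabel e)
      slot (at-y e)   = inj₂ (inLabel e)
      slot-injective : ∀ {c c′} (p : Used c) (q : Used c′) → slot p ≡ slot q → c ≡ c′
      slot-injective (at-w ne e) (at-w _ e′) eq = unique M ne (inLabel-injective e e′ (inj₁-injective eq))
      slot-injective (at-y e)    (at-y e′)   eq =
        unique M (λ fix → ℕ.<⇒≢ (E⇒< e) (cong toℕ fix)) (inLabel-injective e e′ (inj₂-injective eq))
      f : Fin (suc k) → Fin (d + d)
      f zero    = join d d (inj₁ (inLabel vw))
      f (suc c) = join d d (slot (used c))
      new : ∀ {c} (p : Used c) → slot p ≢ inj₁ (inLabel vw)
      new {c} (at-w _ e) eq = vw∉ (c , mate-sym M (inLabel-injective e vw (inj₁-injective eq)))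
      unjoin : ∀ {p q} → join d d p ≡ join d d q → p ≡ q
      unjoin {p} {q} eq = trans (sym (Fin.splitAt-join d d p)) (trans (cong (Fin.splitAt d) eq) (Fin.splitAt-join d d q))
      f-inj : ∀ {i j} → f i ≡ f j → i ≡ j
      f-inj {zero}  {zero}  _  = refl
      f-inj {zero}  {suc j} eq = contradiction (sym (unjoin eq)) (new (used j))
      f-inj {suc i} {zero}  eq = contradiction (unjoin eq) (new (used i))
      f-inj {suc i} {suc j} eq = cong suc (slot-injective (used i) (used j) (unjoin eq))

    module _ {α : Fin k} (w∌α : mate M α w ≡ w) (¬parent : ¬ E (mate M α v) v) (v∋α : mate M α v ≢ v) where

      x : Fin n
      x = mate M α v

      vx : E v x
      vx with sound M v∋α
      ... | inj₁ (e , _) = e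
      ... | inj₂ (e , _) = contradiction e ¬parent

      insert-shift : ∃ λ M′ → M ⊑ M′ × Coloured M′ v w
      insert-shift
        with β , v∌β ← missing
           | γ , w∌γ , ¬e ← missing-avoiding x
        = result
        where
        -- As a child of `v`, the vertex `x` comes after `v`, so its coloured edges all lead to
        -- parents, and `γ` was chosen to lead to none.
        x∌γ : mate M γ x ≡ x
        x∌γ with mate M γ x Fin.≟ x
        ... | yes eq = eq
        ... | no ne  = contradiction (later⇒parent (E⇒< vx) ne) ¬e
        γ≢α : γ ≢ α
        γ≢α refl = v∋α (sym (trans (sym (involutive M γ v)) x∌γ))
        β≢α : β ≢ α
        β≢α refl = v∋α v∌β
        w≢x : w ≢ x
        w≢x refl = vw∉ (α , refl)
        open AlternatingWalk (mate M γ) (mate M β) (involutive M γ) (involutive M β) v v∌β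
        -- The edge `v x` hands its colour `α` over to `v w` and is itself left uncoloured in `M₁`.
        rest : Fin n → Fin n
        rest = cut v x (mate M α)
        open Recolour M α rest (cut-involutive (involutive M α) refl) (proj₁ ∘ cut-moved)
                      cut-≡ˡ (cut-fixed w∌α) Rvw Rwv vw∉ renaming (recolour to M₁)
        vx∉M₁ : ¬ Coloured M₁ v x
        vx∉M₁ (c , eq) = cases (c Fin.≟ α)
          where
          cases : ¬ Dec (c ≡ α)
          cases (yes refl) = w≢x (trans (sym recolour-v) eq)
          cases (no c≢α)   = c≢α (sym (unique M v∋α (sym (trans (sym (recolour-≢ c≢α v)) eq))))
        -- Passing from `M` to `M₁` loses only the edge `v x`, so a colouring that extends `M₁` and
        -- colours `v x` extends `M` as well.
        kept : ∀ {M′} → M₁ ⊑ M′ → Coloured M′ v x → M ⊑ M′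
        kept {M′} M₁⊑M′ (c′ , vx∈) {u} {y} u≢y (c , eq) = cases (c Fin.≟ α) (u Fin.≟ v) (u Fin.≟ x)
          where
          cases : Dec (c ≡ α) → Dec (u ≡ v) → Dec (u ≡ x) → Coloured M′ u y
          cases (no c≢α)   _          _          = M₁⊑M′ u≢y (c , trans (recolour-≢ c≢α u) eq)
          cases (yes refl) (yes refl) _          = c′ , trans vx∈ eq
          cases (yes refl) (no _)     (yes refl) = c′ , trans (mate-sym M′ vx∈) (trans (sym (involutive M α v)) eq)
          cases (yes refl) (no u≢v)   (no u≢x)   = M₁⊑M′ u≢y (recolour-f u≢y (trans (cut-≢ u≢v u≢x) eq))
        via-w : ¬ Component w → ∃ λ M′ → M ⊑ M′ × Coloured M′ v w
        via-w w∉ = add-flipped M γ β {Component} component? closedᵃ closedᵇ start w∉ v∌β w∌γ Rvw Rwv vw∉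
        -- The chain was computed in `M` but is closed in `M₁` too, because only the class of `α`
        -- has changed and `α` is neither `γ` nor `β`.
        add-vx : ¬ Component x → ∃ λ M′ → M₁ ⊑ M′ × Coloured M′ v x
        add-vx x∉ = add-flipped M₁ γ β {Component} component?
          (λ {u} u∈ → subst Component (sym (recolour-≢ γ≢α u)) (closedᵃ u∈))
          (λ {u} u∈ → subst Component (sym (recolour-≢ β≢α u)) (closedᵇ u∈))
          start x∉ (trans (recolour-≢ β≢α v) v∌β) (trans (recolour-≢ γ≢α x) x∌γ)
          (inj₁ (vx , ℕ.≤-refl)) (inj₂ (vx , ℕ.≤-refl)) vx∉M₁
        via-x : (∃ λ M′ → M₁ ⊑ M′ × Coloured M′ v x) → ∃ λ M′ → M ⊑ M′ × Coloured M′ v w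
        via-x (M′ , M₁⊑M′ , vx∈) =
          M′ , kept {M′} M₁⊑M′ vx∈ , M₁⊑M′ (λ v≡w → ℕ.<⇒≢ (E⇒< vw) (cong toℕ v≡w)) (α , recolour-v)
        result : ∃ λ M′ → M ⊑ M′ × Coloured M′ v w
        -- Both `w` and `x` miss `γ`, so each could only be the last vertex of the chain from `v`.
        result = Sum.[ via-w , via-x ∘ add-vx ] (avoids w≢x w∌γ x∌γ)

    insert : ∃ λ M′ → M ⊑ M′ × Coloured M′ v w
    insert with α , w∌α , ¬parent ← missing-avoiding v | mate M α v Fin.≟ v
    ... | yes v∌α = add M α v∌α w∌α Rvw Rwv vw∉
    ... | no v∋α  = insert-shift w∌α ¬parent v∋α

  insert-all : ∀ v (ws : List (Fin n)) (M : Colouring n k (UpTo v)) →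
               ∃ λ M′ → M ⊑ M′ × (∀ {w} → w ∈ ws → E v w → Coloured M′ v w)
  insert-all v []       M = M , (λ _ → id) , λ ()
  insert-all v (w ∷ ws) M with M₁ , M⊑M₁ , done ← insert-all v ws M
    with E? v w | Fin.any? (λ c → mate M₁ c v Fin.≟ w)
  ... | no ¬e | _      = M₁ , M⊑M₁ , λ { (here refl) e → contradiction e ¬e ; (there w∈) → done w∈ }
  ... | yes _ | yes vw = M₁ , M⊑M₁ , λ { (here refl) _ → vw ; (there w∈) → done w∈ }
  ... | yes e | no vw∉ with M₂ , M₁⊑M₂ , vw ← Insert.insert M₁ e vw∉ =
    M₂ , (λ u≢x → M₁⊑M₂ u≢x ∘ M⊑M₁ u≢x) ,
    λ { (here refl) _ → vw
      ; (there w∈) e′ → M₁⊑M₂ (λ v≡w → ℕ.<⇒≢ (E⇒< e′) (cong toℕ v≡w)) (done w∈ e′) }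

  Before : ℕ → Fin n → Fin n → Set
  Before t u x = (E u x × toℕ u < t) ⊎ (E x u × toℕ x < t)

  relax : ∀ {R R′ : Fin n → Fin n → Set} → (∀ {u x} → R u x → R′ u x) → Colouring n k R → Colouring n k R′
  relax R⊆R′ M = record
    { mate = mate M ; involutive = involutive M ; unique = unique M ; sound = R⊆R′ ∘ sound M }

  -- Induction over the parents. When the turn of `v` comes, all coloured edges have parents before
  -- `v`, so the invariant `UpTo v` of the insertions holds at the start of the round.
  colour-before : ∀ t → t ≤ n → Σ (Colouring n k (Before t)) λ M → ∀ {u x} → E u x → toℕ u < t → Coloured M u x
  colour-before zero _ = record
    { mate = λ _ u → u ; involutive = λ _ _ → refl
    ; unique = λ ne → contradiction refl ne ; sound = λ ne → contradiction refl ne } , λ _ ()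
  colour-before (suc t) t<n with M , complete ← colour-before t (ℕ.<⇒≤ t<n)
    = relax (Sum.map (λ (e , le) → e , s≤s (ℕ.≤-trans le (ℕ.≤-reflexive v≡t)))
                     (λ (e , le) → e , s≤s (ℕ.≤-trans le (ℕ.≤-reflexive v≡t)))) (proj₁ all) , complete′
    where
    v = fromℕ< t<n
    v≡t : toℕ v ≡ t
    v≡t = Fin.toℕ-fromℕ< t<n
    M₁ : Colouring n k (UpTo v)
    M₁ = relax (Sum.map (λ (e , lt) → e , ℕ.≤-trans (ℕ.<⇒≤ lt) (ℕ.≤-reflexive (sym v≡t)))
                        (λ (e , lt) → e , ℕ.≤-trans (ℕ.<⇒≤ lt) (ℕ.≤-reflexive (sym v≡t)))) M
    all = insert-all v (allFin n) M₁
    complete′ : ∀ {u x} → E u x → toℕ u < suc t → Coloured (proj₁ all) u x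
    complete′ {u} {x} e u<1+t with ℕ.m≤n⇒m<n∨m≡n (ℕ.≤-pred u<1+t)
    ... | inj₁ u<t = proj₁ (proj₂ all) (λ u≡x → ℕ.<⇒≢ (E⇒< e) (cong toℕ u≡x)) (complete e u<t)
    ... | inj₂ u≡t with refl ← Fin.toℕ-injective (trans u≡t (sym v≡t)) =
      proj₂ (proj₂ all) (∈-allFin x) e

  degenerate⇒colouring : Σ (Colouring n k λ u x → E u x ⊎ E x u) λ M → ∀ {u x} → E u x → Coloured M u x
  degenerate⇒colouring with M , complete ← colour-before n ℕ.≤-refl =
    relax (Sum.map proj₁ proj₁) M , λ {u} e → complete e (Fin.toℕ<n u)

-- Free positions and the splitting of the edges into classes.

module _ {A : Set} where

  lookup-injective : {xs : List A} → Unique xs → ∀ i j → lookup xs i ≡ lookup xs j → i ≡ j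
  lookup-injective (_ ∷ _)   zero    zero    _  = refl
  lookup-injective (x∉ ∷ _)  zero    (suc j) eq = contradiction eq (All.lookup x∉ (∈-lookup j))
  lookup-injective (x∉ ∷ _)  (suc i) zero    eq = contradiction (sym eq) (All.lookup x∉ (∈-lookup i))
  lookup-injective (_ ∷ xs!) (suc i) (suc j) eq = cong suc (lookup-injective xs! i j eq)

  -- The map may depend on the membership proof, since some labels exist only for selected edges.
  unique-length-≤ : ∀ {xs : List A} {N} → Unique xs → (f : ∀ {x} → x ∈ xs → Fin N) →
                    (∀ {x y} (x∈ : x ∈ xs) (y∈ : y ∈ xs) → f x∈ ≡ f y∈ → x ≡ y) → length xs ≤ N
  unique-length-≤ xs! f f-inj =
    Fin.injective⇒≤ {f = λ k → f (∈-lookup k)} (λ {i} {j} eq → lookup-injective xs! i j (f-inj _ _ eq))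

  unique-⊆-length : ∀ {xs ys : List A} → Unique xs → (∀ {x} → x ∈ xs → x ∈ ys) → length xs ≤ length ys
  unique-⊆-length {ys = ys} xs! xs⊆ys = unique-length-≤ xs! (index ∘ xs⊆ys) λ x∈ y∈ eq →
    trans (lookup-index (xs⊆ys x∈)) (trans (cong (lookup ys) eq) (sym (lookup-index (xs⊆ys y∈))))

  ∈-take-tabulate⁺ : ∀ {m} (f : Fin m → A) t {x} → toℕ x < t → f x ∈ take t (tabulate f)
  ∈-take-tabulate⁺ f (suc t) {zero}  _       = here refl
  ∈-take-tabulate⁺ f (suc t) {suc x} (s≤s p) = there (∈-take-tabulate⁺ (f ∘ suc) t p)

  ∈-take-tabulate⁻ : ∀ {m} (f : Fin m → A) t {y} → y ∈ take t (tabulate f) → ∃ λ x → toℕ x < t × y ≡ f x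
  ∈-take-tabulate⁻ {suc m} f (suc t) (here eq) = zero , z<s , eq
  ∈-take-tabulate⁻ {suc m} f (suc t) (there y∈) with x , lt , eq ← ∈-take-tabulate⁻ (f ∘ suc) t y∈ =
    suc x , s<s lt , eq

-- The increasing enumeration of the numbers other than `s`; `unskip s` is a left inverse.
skip : ℕ → ℕ → ℕ
skip s t with t ℕ.<? s
... | yes _ = t
... | no _  = suc t

unskip : ℕ → ℕ → ℕ
unskip s x with x ℕ.≤? s
... | yes _ = x
... | no _  = x ∸ 1

skip-≢ : ∀ s t → skip s t ≢ s
skip-≢ s t eq with t ℕ.<? s
... | yes t<s = ℕ.<⇒≢ t<s eq
... | no t≮s  = t≮s (ℕ.≤-reflexive eq)

unskip-skip : ∀ s t → unskip s (skip s t) ≡ t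
unskip-skip s t with t ℕ.<? s
unskip-skip s t | yes t<s with t ℕ.≤? s
... | yes _  = refl
... | no t≰s = contradiction (ℕ.<⇒≤ t<s) t≰s
unskip-skip s t | no t≮s with suc t ℕ.≤? s
... | yes t<s = contradiction t<s t≮s
... | no _    = refl

skip-≥ : ∀ s t → t ≤ skip s t
skip-≥ s t with t ℕ.<? s
... | yes _ = ℕ.≤-refl
... | no _  = ℕ.n≤1+n t

skip-≤ : ∀ s t → skip s t ≤ suc t
skip-≤ s t with t ℕ.<? s
... | yes _ = ℕ.n≤1+n t
... | no _  = ℕ.≤-refl

-- The t-th natural number outside the image of xs under g.
free : {A : Set} → (A → ℕ) → List A → ℕ → ℕ
free g []       t = t
free g (x ∷ xs) t = skip (g x) (free (unskip (g x) ∘ g) xs t)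

module _ {A : Set} where

  free-∉ : ∀ (g : A → ℕ) xs t {x} → x ∈ xs → free g xs t ≢ g x
  free-∉ g (x ∷ xs) t (here refl) = skip-≢ (g x) _
  free-∉ g (x ∷ xs) t (there y∈)  eq =
    free-∉ _ xs t y∈ (trans (sym (unskip-skip (g x) _)) (cong (unskip (g x)) eq))

  free-injective : ∀ (g : A → ℕ) xs {t t′} → free g xs t ≡ free g xs t′ → t ≡ t′
  free-injective g []       eq = eq
  free-injective g (x ∷ xs) eq = free-injective _ xs
    (trans (sym (unskip-skip (g x) _)) (trans (cong (unskip (g x)) eq) (unskip-skip (g x) _)))

  free-≥ : ∀ (g : A → ℕ) xs t → t ≤ free g xs t
  free-≥ g []       t = ℕ.≤-refl
  free-≥ g (x ∷ xs) t = ℕ.≤-trans (free-≥ _ xs t) (skip-≥ (g x) _)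

  -- Each entry of `xs` pushes the value up by at most one. Together with `free-≥` this is what lets
  -- a single bit communicate the class.
  free-≤ : ∀ (g : A → ℕ) xs t → free g xs t ≤ t + length xs
  free-≤ g []       t = ℕ.≤-reflexive (sym (ℕ.+-identityʳ t))
  free-≤ g (x ∷ xs) t = ℕ.≤-trans (skip-≤ (g x) _)
    (ℕ.≤-trans (s≤s (free-≤ _ xs t)) (ℕ.≤-reflexive (sym (ℕ.+-suc t (length xs)))))

  free-cong : ∀ {g h : A → ℕ} xs t → (∀ {x} → x ∈ xs → g x ≡ h x) → free g xs t ≡ free h xs t
  free-cong         []       t g≗h = refl
  free-cong {g} {h} (x ∷ xs) t g≗h = cong₂ skip (g≗h (here refl))
    (free-cong xs t λ y∈ → cong₂ unskip (g≗h (here refl)) (g≗h (there y∈)))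

-- A parent edge has got its class at its parent, and occupies the position in that
-- class given by its label; processing the vertices in order, positions are computed
-- with the index of the parent as fuel.
module Blocks {m n d : ℕ} (b : ℕ) .{{_ : NonZero b}} (d≤b : d ≤ b)
  (par chi : Fin m → Fin n) (par<chi : ∀ i → par i Fin.< chi i)
  (inLabel : Fin m → Fin d) (inLabel-injective : ∀ {i j} → chi i ≡ chi j → inLabel i ≡ inLabel j → i ≡ j)
  {Sel : Fin m → Set} (Sel? : Decidable Sel) where

  siblings : Fin m → List (Fin m)
  siblings i = filter (λ j → Sel? j ×-dec (par j Fin.≟ par i)) (take (toℕ i) (allFin m))

  rank : Fin m → ℕ
  rank i = length (siblings i)

  parentEdges : Fin n → List (Fin m)
  parentEdges u = filter (λ j → Sel? j ×-dec (chi j Fin.≟ u)) (allFin m)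

  occupied : (Fin m → ℕ) → Fin m → ℕ
  occupied pos j = toℕ (inLabel j) + pos j / b * b

  positionUpTo : ℕ → Fin m → ℕ
  positionUpTo zero    i = 0
  positionUpTo (suc t) i = free (occupied (positionUpTo t)) (parentEdges (par i)) (rank i)

  parentEdges⁻ : ∀ {u j} → j ∈ parentEdges u → Sel j × chi j ≡ u
  parentEdges⁻ {u} j∈ = proj₂ (∈-filter⁻ (λ j → Sel? j ×-dec (chi j Fin.≟ u)) {xs = allFin m} j∈)

  parentEdges⁺ : ∀ {u j} → Sel j → chi j ≡ u → j ∈ parentEdges u
  parentEdges⁺ sj cj = ∈-filter⁺ (λ j → Sel? j ×-dec (chi j Fin.≟ _)) (∈-allFin _) (sj , cj)

  siblings⁻ : ∀ {i j} → j ∈ siblings i → toℕ j < toℕ i × Sel j × par j ≡ par i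
  siblings⁻ {i} j∈
    with j∈take , sel ← ∈-filter⁻ (λ j → Sel? j ×-dec (par j Fin.≟ par i)) {xs = take (toℕ i) (allFin m)} j∈
    with _ , j<i , refl ← ∈-take-tabulate⁻ id (toℕ i) j∈take = j<i , sel

  siblings⁺ : ∀ {i j} → toℕ j < toℕ i → Sel j → par j ≡ par i → j ∈ siblings i
  siblings⁺ {i} j<i sj pj =
    ∈-filter⁺ (λ j → Sel? j ×-dec (par j Fin.≟ par i)) (∈-take-tabulate⁺ id (toℕ i) j<i) (sj , pj)

  i∷siblings! : ∀ i → Unique (i ∷ siblings i)
  i∷siblings! i = All.tabulate (λ j∈ i≡j → ℕ.<⇒≢ (proj₁ (siblings⁻ j∈)) (cong toℕ (sym i≡j)))
                ∷ Unique.filter⁺ _ (Unique.take⁺ (toℕ i) (Unique.allFin⁺ m))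

  parentEdges! : ∀ u → Unique (parentEdges u)
  parentEdges! u = Unique.filter⁺ _ (Unique.allFin⁺ m)

  -- An edge `j` to a parent of `par i` satisfies `par j < chi j = par i`, so one unit of fuel less
  -- suffices for it.
  positionUpTo-stable : ∀ t t′ {i} → toℕ (par i) < t → toℕ (par i) < t′ → positionUpTo t i ≡ positionUpTo t′ i
  positionUpTo-stable (suc t) (suc t′) {i} lt lt′ = free-cong (parentEdges (par i)) (rank i) λ {j} j∈ →
    cong (λ p → toℕ (inLabel j) + p / b * b) (positionUpTo-stable t t′ (before j∈ lt) (before j∈ lt′))
    where
    before : ∀ {j s} → j ∈ parentEdges (par i) → toℕ (par i) < suc s → toℕ (par j) < s
    before {j} j∈ lt =
      ℕ.<-≤-trans (ℕ.<-≤-trans (par<chi j) (ℕ.≤-reflexive (cong toℕ (proj₂ (parentEdges⁻ j∈))))) (ℕ.≤-pred lt)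

  position : Fin m → ℕ
  position = positionUpTo n

  class : Fin m → ℕ
  class i = position i / b

  position-≡ : ∀ i → position i ≡ free (occupied position) (parentEdges (par i)) (rank i)
  position-≡ i = trans (positionUpTo-stable n (suc n) (Fin.toℕ<n (par i)) (ℕ.m≤n⇒m≤1+n (Fin.toℕ<n (par i)))) refl

  parentEdges-≤d : ∀ u → length (parentEdges u) ≤ d
  parentEdges-≤d u = unique-length-≤ (parentEdges! u) (λ {j} _ → inLabel j)
    λ i∈ j∈ → inLabel-injective (trans (proj₂ (parentEdges⁻ i∈)) (sym (proj₂ (parentEdges⁻ j∈))))

  -- The position lies between `rank i` and `rank i + d`, and `d ≤ b`, so division by `b` leaves
  -- only two possible quotients.
  class-shift : ∀ i → ∃ λ (s : Bool) → class i ≡ rank i / b + (if s then 1 else 0)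
  class-shift i with ℕ.m≤n⇒m<n∨m≡n lower
    where
    lower : rank i / b ≤ class i
    lower = /-monoˡ-≤ b (ℕ.≤-trans (free-≥ _ (parentEdges (par i)) (rank i)) (ℕ.≤-reflexive (sym (position-≡ i))))
  ... | inj₂ eq = false , trans (sym eq) (sym (ℕ.+-identityʳ _))
  ... | inj₁ lt = true , ℕ.≤-antisym upper (ℕ.≤-trans (ℕ.≤-reflexive (ℕ.+-comm (rank i / b) 1)) lt)
    where
    open ℕ.≤-Reasoning
    upper : class i ≤ rank i / b + 1
    upper = begin
      position i / b        ≡⟨ cong (_/ b) (position-≡ i) ⟩
      free (occupied position) (parentEdges (par i)) (rank i) / b
                            ≤⟨ /-monoˡ-≤ b (free-≤ _ (parentEdges (par i)) (rank i)) ⟩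
      (rank i + length (parentEdges (par i))) / b
                            ≤⟨ /-monoˡ-≤ b (ℕ.+-monoʳ-≤ (rank i) (ℕ.≤-trans (parentEdges-≤d (par i)) d≤b)) ⟩
      (rank i + b) / b      ≡⟨ +-distrib-/-∣ʳ (rank i) ∣-refl ⟩
      rank i / b + b / b    ≡⟨ cong (rank i / b +_) (n/n≡1 b) ⟩
      rank i / b + 1        ∎

  Incident : Fin n → Fin m → Set
  Incident u i = par i ≡ u ⊎ chi i ≡ u

  -- The edge `i`, its earlier siblings and the parent edges of `par i` are distinct selected edges
  -- at one vertex. In the proper colouring `base` they get distinct colours among `q * b`, and
  -- their number exceeds `position i`.
  class-< : ∀ {N} q → N ≡ q * b → (base : ∀ {i} → Sel i → Fin N) →
            (∀ {u i j} (si : Sel i) (sj : Sel j) → Incident u i → Incident u j → base si ≡ base sj → i ≡ j) →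
            ∀ {i} → Sel i → class i < q
  class-< {N} q N≡qb base base-proper {i} si = m<n*o⇒m/o<n (begin
    suc (position i)                                  ≡⟨ cong suc (position-≡ i) ⟩
    suc (free (occupied position) (parentEdges (par i)) (rank i))
                                                      ≤⟨ s≤s (free-≤ _ (parentEdges (par i)) (rank i)) ⟩
    suc (rank i) + length (parentEdges (par i))       ≡⟨ List.length-++ (i ∷ siblings i) ⟨
    length (i ∷ siblings i ++ parentEdges (par i))    ≤⟨ unique-length-≤ atPar! (base ∘ proj₁ ∘ at) (λ i∈ j∈ →
                                                           base-proper _ _ (proj₂ (at i∈)) (proj₂ (at j∈))) ⟩
    N                                                 ≡⟨ N≡qb ⟩
    q * b                                             ∎)
    where
    open ℕ.≤-Reasoning
    out : ∀ {j} → j ∈ i ∷ siblings i → Sel j × par j ≡ par i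
    out (here refl) = si , refl
    out (there j∈)  = proj₂ (siblings⁻ j∈)
    at : ∀ {j} → j ∈ i ∷ siblings i ++ parentEdges (par i) → Sel j × Incident (par i) j
    at j∈ with ∈-++⁻ (i ∷ siblings i) j∈
    ... | inj₁ j∈out = proj₁ (out j∈out) , inj₁ (proj₂ (out j∈out))
    ... | inj₂ j∈in  = proj₁ (parentEdges⁻ j∈in) , inj₂ (proj₂ (parentEdges⁻ j∈in))
    atPar! : Unique (i ∷ siblings i ++ parentEdges (par i))
    atPar! = Unique.++⁺ (i∷siblings! i) (parentEdges! (par i)) λ {j} (j∈out , j∈in) →
      ℕ.<⇒≢ (par<chi j) (cong toℕ (trans (proj₂ (out j∈out)) (sym (proj₂ (parentEdges⁻ j∈in)))))

  -- The place within its block of the position that the edge takes at `u`: a remainder modulo `b`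
  -- at the parent, the prescribed label at the child.
  blockLabel : ∀ {u i} → Incident u i → Fin b
  blockLabel {i = i} (inj₁ _) = fromℕ< (m%n<n (position i) b)
  blockLabel {i = i} (inj₂ _) = Fin.inject≤ (inLabel i) d≤b

  rank-< : ∀ {i j} → Sel i → par i ≡ par j → toℕ i < toℕ j → rank i < rank j
  rank-< {i} {j} si pi≡pj i<j = unique-⊆-length (i∷siblings! i) λ
    { (here refl) → siblings⁺ i<j si pi≡pj
    ; (there k∈)  → let k<i , sk , pk = siblings⁻ k∈ in siblings⁺ (ℕ.<-trans k<i i<j) sk (trans pk pi≡pj) }

  -- Among the selected edges of one parent, `rank` strictly increases with arrival, and `free` is
  -- injective in the rank.
  position-injective : ∀ {i j} → Sel i → Sel j → par i ≡ par j → position i ≡ position j → i ≡ j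
  position-injective {i} {j} si sj pi≡pj eq with ℕ.<-cmp (toℕ i) (toℕ j)
  ... | tri≈ _ i≡j _ = Fin.toℕ-injective i≡j
  ... | tri< i<j _ _ = contradiction ranks (ℕ.<⇒≢ (rank-< si pi≡pj i<j))
    where
    ranks : rank i ≡ rank j
    ranks = free-injective (occupied position) (parentEdges (par i)) (trans (sym (position-≡ i))
      (trans eq (trans (position-≡ j) (cong (λ u → free (occupied position) (parentEdges u) (rank j)) (sym pi≡pj)))))
  ... | tri> _ _ j<i = contradiction ranks (ℕ.<⇒≢ (rank-< sj (sym pi≡pj) j<i))
    where
    ranks : rank j ≡ rank i
    ranks = free-injective (occupied position) (parentEdges (par j)) (trans (sym (position-≡ j))
      (trans (sym eq) (trans (position-≡ i) (cong (λ u → free (occupied position) (parentEdges u) (rank i)) pi≡pj))))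

  position-∉ : ∀ {i j} → Sel j → chi j ≡ par i → class i ≡ class j → position i % b ≢ toℕ (inLabel j)
  position-∉ {i} {j} sj cj≡pi ci≡cj eq =
    free-∉ (occupied position) (parentEdges (par i)) (rank i) (parentEdges⁺ sj cj≡pi) (begin
      free (occupied position) (parentEdges (par i)) (rank i) ≡⟨ position-≡ i ⟨
      position i                       ≡⟨ m≡m%n+[m/n]*n (position i) b ⟩
      position i % b + class i * b     ≡⟨ cong₂ (λ x y → x + y * b) eq ci≡cj ⟩
      occupied position j              ∎)
    where open ≡-Reasoning

  -- This bounds the degree of `u` within one class by `b`. Two child edges have different
  -- positions, a child edge avoids the positions occupied by parent edges, and two parent edges
  -- have different labels.
  blockLabel-injective : ∀ {u i j} (pi : Incident u i) (pj : Incident u j) → Sel i → Sel j →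
                         class i ≡ class j → blockLabel pi ≡ blockLabel pj → i ≡ j
  blockLabel-injective {i = i} {j} (inj₁ pi) (inj₁ pj) si sj ci≡cj eq =
    position-injective si sj (trans pi (sym pj)) (begin
      position i                      ≡⟨ m≡m%n+[m/n]*n (position i) b ⟩
      position i % b + class i * b    ≡⟨ cong₂ (λ x y → x + y * b) (Fin.fromℕ<-injective _ _ _ _ eq) ci≡cj ⟩
      position j % b + class j * b    ≡⟨ m≡m%n+[m/n]*n (position j) b ⟨
      position j                      ∎)
    where open ≡-Reasoning
  blockLabel-injective (inj₁ pi) (inj₂ cj) si sj ci≡cj eq = contradiction
    (trans (sym (Fin.toℕ-fromℕ< _)) (trans (cong toℕ eq) (Fin.toℕ-inject≤ _ d≤b)))
    (position-∉ sj (trans cj (sym pi)) ci≡cj)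
  blockLabel-injective (inj₂ ci) (inj₁ pj) si sj ci≡cj eq = contradiction
    (trans (sym (Fin.toℕ-fromℕ< _)) (trans (cong toℕ (sym eq)) (Fin.toℕ-inject≤ _ d≤b)))
    (position-∉ si (trans ci (sym pj)) (sym ci≡cj))
  blockLabel-injective (inj₂ ci) (inj₂ cj) si sj ci≡cj eq =
    inLabel-injective (trans ci (sym cj)) (Fin.inject≤-injective d≤b d≤b _ _ eq)

-- Colouring a selected set of indexed edges.

module _ {m n d k : ℕ} (2d≤k : d + d ≤ k) {par chi : Fin m → Fin n} (par<chi : ∀ i → par i Fin.< chi i)
  (simple : ∀ {i j} → par i ≡ par j → chi i ≡ chi j → i ≡ j)
  (inLabel : Fin m → Fin d) (inLabel-injective : ∀ {i j} → chi i ≡ chi j → inLabel i ≡ inLabel j → i ≡ j)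
  {P : Fin m → Set} (P? : Decidable P)
  (label : ∀ {u i} → par i ≡ u ⊎ chi i ≡ u → Fin k)
  (label-injective : ∀ {u i j} (pi : par i ≡ u ⊎ chi i ≡ u) (pj : par j ≡ u ⊎ chi j ≡ u) →
                     P i → P j → label pi ≡ label pj → i ≡ j) where

  -- Transfers `degenerate⇒colouring` from vertex pairs to edge indices. Equal colours at a common
  -- vertex mean equal mates there, and by `simple` the two ends determine the edge.
  edges-colourable : Σ (∀ {i} → P i → Fin k) λ colour →
    ∀ {u i j} (Pi : P i) (Pj : P j) → par i ≡ u ⊎ chi i ≡ u → par j ≡ u ⊎ chi j ≡ u →
    colour Pi ≡ colour Pj → i ≡ j
  edges-colourable = colour , λ Pi Pj → proper Pi Pj
    where
    E : Fin n → Fin n → Set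
    E p c = ∃ λ i → P i × par i ≡ p × chi i ≡ c
    E? : ∀ p c → Dec (E p c)
    E? p c = Fin.any? λ i → P? i ×-dec (par i Fin.≟ p) ×-dec (chi i Fin.≟ c)
    E⇒< : ∀ {p c} → E p c → p Fin.< c
    E⇒< (i , _ , refl , refl) = par<chi i
    loop : ∀ {u i} → par i ≡ u → chi i ≡ u → ∀ {A : Set} → A
    loop {i = i} pi ci = contradiction (cong toℕ (trans pi (sym ci))) (ℕ.<⇒≢ (par<chi i))
    vLabel : ∀ {u x} → E u x ⊎ E x u → Fin k
    vLabel (inj₁ (i , _ , pi , _)) = label {i = i} (inj₁ pi)
    vLabel (inj₂ (i , _ , _ , ci)) = label {i = i} (inj₂ ci)
    vLabel-injective : ∀ {u x y} (e : E u x ⊎ E x u) (f : E u y ⊎ E y u) → vLabel e ≡ vLabel f → x ≡ y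
    vLabel-injective (inj₁ (i , Pi , pi , ci)) (inj₁ (j , Pj , pj , cj)) eq
      with refl ← label-injective (inj₁ pi) (inj₁ pj) Pi Pj eq = trans (sym ci) cj
    vLabel-injective (inj₁ (i , Pi , pi , ci)) (inj₂ (j , Pj , pj , cj)) eq
      with refl ← label-injective (inj₁ pi) (inj₂ cj) Pi Pj eq = loop pi cj
    vLabel-injective (inj₂ (i , Pi , pi , ci)) (inj₁ (j , Pj , pj , cj)) eq
      with refl ← label-injective (inj₂ ci) (inj₁ pj) Pi Pj eq = loop pj ci
    vLabel-injective (inj₂ (i , Pi , pi , ci)) (inj₂ (j , Pj , pj , cj)) eq
      with refl ← label-injective (inj₂ ci) (inj₂ cj) Pi Pj eq = trans (sym pi) pj
    inL : ∀ {p c} → E p c → Fin d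
    inL (i , _) = inLabel i
    inL-injective : ∀ {p p′ c} (e : E p c) (e′ : E p′ c) → inL e ≡ inL e′ → p ≡ p′
    inL-injective (i , _ , pi , ci) (j , _ , pj , cj) eq with refl ← inLabel-injective (trans ci (sym cj)) eq =
      trans (sym pi) pj
    M,complete = degenerate⇒colouring 2d≤k E? E⇒< inL inL-injective vLabel vLabel-injective
    M = proj₁ M,complete
    coloured : ∀ {i} → P i → ∃ λ c → mate M c (par i) ≡ chi i
    coloured {i} Pi = proj₂ M,complete (i , Pi , refl , refl)
    colour : ∀ {i} → P i → Fin k
    colour Pi = proj₁ (coloured Pi)
    proper : ∀ {u i j} (Pi : P i) (Pj : P j) → par i ≡ u ⊎ chi i ≡ u → par j ≡ u ⊎ chi j ≡ u →
             colour Pi ≡ colour Pj → i ≡ j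
    proper {u} {i} {j} Pi Pj ui uj eq with colour Pi | proj₂ (coloured Pi) | colour Pj | proj₂ (coloured Pj)
    proper (Pi) (Pj) (inj₁ pi) (inj₁ pj) refl | c | ei | _ | ej =
      simple (trans pi (sym pj)) (trans (sym ei) (trans (cong (mate M c) (trans pi (sym pj))) ej))
    -- The two edges would join the same vertices in opposite directions, giving
    -- `par i < chi i = par j < chi j = par i`.
    proper {i = i} {j} (Pi) (Pj) (inj₁ pi) (inj₂ cj) refl | c | ei | _ | ej =
      contradiction (ℕ.<-trans (par<chi j) (subst₂ Fin._<_ (trans pi (sym cj)) ci≡pj (par<chi i))) (ℕ.<-irrefl refl)
      where ci≡pj = trans (sym ei) (trans (cong (mate M c) (trans pi (sym cj))) (mate-sym M ej))
    proper {i = i} {j} (Pi) (Pj) (inj₂ ci) (inj₁ pj) refl | c | ei | _ | ej =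
      contradiction (ℕ.<-trans (par<chi i) (subst₂ Fin._<_ (trans pj (sym ci)) cj≡pi (par<chi j))) (ℕ.<-irrefl refl)
      where cj≡pi = trans (sym ej) (trans (cong (mate M c) (trans pj (sym ci))) (mate-sym M ei))
    proper (Pi) (Pj) (inj₂ ci) (inj₂ cj) refl | c | ei | _ | ej =
      simple (trans (sym (mate-sym M ei)) (trans (cong (mate M c) (trans ci (sym cj))) (mate-sym M ej))) (trans ci (sym cj))

-- Advice strings and the online algorithm.

n≤2^⌈log₂n⌉ : ∀ n → n ≤ 2 ^ ⌈log₂ n ⌉
n≤2^⌈log₂n⌉ = <-rec (λ n → n ≤ 2 ^ ⌈log₂ n ⌉) bound
  where
  open ℕ.≤-Reasoning
  bound : ∀ n → (∀ {l} → l < n → l ≤ 2 ^ ⌈log₂ l ⌉) → n ≤ 2 ^ ⌈log₂ n ⌉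
  bound 0               rec = z≤n
  bound 1               rec = s≤s z≤n
  bound n@(suc (suc l)) rec = begin
    n                            ≡⟨ ℕ.⌊n/2⌋+⌈n/2⌉≡n n ⟨
    ⌊ n /2⌋ + ⌈ n /2⌉            ≤⟨ ℕ.+-monoˡ-≤ ⌈ n /2⌉ (ℕ.⌊n/2⌋≤⌈n/2⌉ n) ⟩
    ⌈ n /2⌉ + ⌈ n /2⌉            ≡⟨ cong (⌈ n /2⌉ +_) (ℕ.+-identityʳ _) ⟨
    2 * ⌈ n /2⌉                  ≤⟨ ℕ.*-monoʳ-≤ 2 (rec (ℕ.⌈n/2⌉<n l)) ⟩
    2 ^ suc ⌈log₂ ⌈ n /2⌉ ⌉      ≡⟨ cong (λ e → 2 ^ suc e) (⌈log₂⌈n/2⌉⌉≡⌈log₂n⌉∸1 n) ⟩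
    2 ^ suc (⌈log₂ n ⌉ ∸ 1)      ≡⟨ cong (2 ^_) (ℕ.m+[n∸m]≡n {1} (⌈log₂⌉-mono-≤ {2} {n} (s≤s (s≤s z≤n)))) ⟩
    2 ^ ⌈log₂ n ⌉                ∎

-- (extra, the first endpoint is the parent, shift of the class, colour in the block)
Advice : Set
Advice = Bool × Bool × Bool × ℕ

binary : List Bool → ℕ
binary []       = 0
binary (x ∷ xs) = (if x then 1 else 0) + 2 * binary xs

decode : List Bool → Advice
decode (x ∷ s ∷ t ∷ bits) = x , s , t , binary bits
decode _                  = false , false , false , 0

binary-surjective : ∀ l {c} → c < 2 ^ l → ∃ λ (v : Vec Bool l) → binary (Vec.toList v) ≡ c
binary-surjective zero    (s≤s z≤n) = [] , refl
binary-surjective (suc l) {c} c<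
  with v , eq ← binary-surjective l {c / 2} (m<n*o⇒m/o<n (ℕ.<-≤-trans c< (ℕ.≤-reflexive (ℕ.*-comm 2 (2 ^ l)))))
  with c % 2 | m%n<n c 2 | m≡m%n+[m/n]*n c 2
... | 0 | _ | c≡ = false ∷ v , trans (ℕ.*-comm 2 (binary (Vec.toList v))) (trans (cong (_* 2) eq) (sym c≡))
... | 1 | _ | c≡ = true ∷ v , trans (cong suc (trans (ℕ.*-comm 2 (binary (Vec.toList v))) (cong (_* 2) eq))) (sym c≡)
... | suc (suc _) | s≤s (s≤s ()) | _

decode-surjective : ∀ {l} → 3 ≤ l → ∀ x s t {c} → c < 2 ^ (l ∸ 3) →
                    ∃ λ (v : Vec Bool l) → decode (Vec.toList v) ≡ (x , s , t , c)
decode-surjective {suc (suc (suc l))} _ x s t c< with v , refl ← binary-surjective l c< =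
  x ∷ s ∷ t ∷ v , refl
decode-surjective {suc (suc zero)} (s≤s (s≤s ()))
decode-surjective {suc zero} (s≤s ())

-- For `d ≥ 2`, `⌈log₂ (d + 1)⌉` is at least 2, which leaves room for the three flags besides a
-- colour below `2 * d`. For `d = 1` there are just 3 bits, all of them flags, so a block can have
-- only one colour.
blockSize : ∀ d → 1 ≤ d → ∃ λ b → NonZero b × d ≤ b × (d + d ≤ b ⊎ b ≡ 1) ×
            3 ≤ adviceBits d × b ≤ 2 ^ (adviceBits d ∸ 3)
blockSize (suc zero)    _ = 1 , _ , s≤s z≤n , inj₂ refl , s≤s (s≤s (s≤s z≤n)) , s≤s z≤n
blockSize d@(suc (suc d′)) _ = 2 * d , _ , ℕ.m≤m+n d _ , inj₁ (ℕ.≤-reflexive (cong (d +_) (sym (ℕ.+-identityʳ d)))) ,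
  ℕ.≤-trans (ℕ.m≤n+m 3 ⌈log₂ 2 * d ⌉) fits , ℕ.≤-trans (n≤2^⌈log₂n⌉ (2 * d)) (ℕ.^-monoʳ-≤ 2 (ℕ.m+n≤o⇒m≤o∸n ⌈log₂ 2 * d ⌉ fits))
  where
  fits : ⌈log₂ 2 * d ⌉ + 3 ≤ adviceBits d
  fits = ℕ.≤-trans (ℕ.≤-reflexive (ℕ.+-suc ⌈log₂ 2 * d ⌉ 2)) (ℕ.+-monoʳ-≤ (suc ⌈log₂ 2 * d ⌉) (⌈log₂⌉-mono-≤ {3} {d + 1} (s≤s (s≤s (ℕ.m≤n+m 1 d′)))))

parentOf : Edge → Bool → Vertex
parentOf (u , v) side = if side then u else v

-- The online view of `siblings`: earlier advice reveals which edges are extra and which endpoint is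
-- the parent, so the algorithm can compute `rank` itself.
Counted : Vertex → Edge × Advice → Set
Counted u (e , extra , side , _) = extra ≡ false × parentOf e side ≡ u

counted? : ∀ u → Decidable (Counted u)
counted? u (e , extra , side , _) = (extra Bool.≟ false) ×-dec (parentOf e side ℕ.≟ u)

-- The newest edge comes first. The number of extra colours is unknown to the algorithm but smaller
-- than `b`, so the blocks start at colour `b`.
nextColour : ∀ b .{{_ : NonZero b}} → List (Edge × Advice) → ℕ
nextColour b []                                     = 0
nextColour b ((_ , true  , _ , _ , c) ∷ _)          = c
nextColour b ((e , false , side , shift , c) ∷ past) =
  b + (c + (length (filter (counted? (parentOf e side)) past) / b + (if shift then 1 else 0)) * b)

online : ∀ {l} b .{{_ : NonZero b}} → OnlineAlgorithm l
online b es bs = nextColour b (reverse (zip es (map (decode ∘ Vec.toList) bs)))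

filter-map-length : ∀ {A B : Set} {P : B → Set} (P? : Decidable P) (f : A → B) xs →
  length (filter P? (map f xs)) ≡ length (filter (P? ∘ f) xs)
filter-map-length P? f []       = refl
filter-map-length P? f (x ∷ xs) with P? (f x)
... | yes _ = cong suc (filter-map-length P? f xs)
... | no _  = filter-map-length P? f xs

module _ {A : Set} where

  reverse-take-suc : ∀ {m} (f : Fin m → A) i →
    reverse (take (suc (toℕ i)) (tabulate f)) ≡ f i ∷ reverse (take (toℕ i) (tabulate f))
  reverse-take-suc f i = trans (cong reverse (List.take-suc-tabulate f i))
    (List.reverse-++ (take (toℕ i) (tabulate f)) (f i ∷ []))

  zip-take-tabulate : ∀ {B C : Set} (h : B → C) {m} (f : Fin m → A) (g : Fin m → B) t →
    zip (take t (tabulate f)) (map h (take t (tabulate g))) ≡ take t (tabulate λ i → f i , h (g i))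
  zip-take-tabulate h {zero}  f g zero    = refl
  zip-take-tabulate h {zero}  f g (suc t) = refl
  zip-take-tabulate h {suc m} f g zero    = refl
  zip-take-tabulate h {suc m} f g (suc t) = cong (_ ∷_) (zip-take-tabulate h (f ∘ suc) (g ∘ suc) t)

  count-before : ∀ {m} {P : A → Set} (P? : Decidable P) (f : Fin m → A) (i : Fin m) →
    length (filter P? (reverse (take (toℕ i) (tabulate f)))) ≡ length (filter (P? ∘ f) (take (toℕ i) (allFin m)))
  count-before {m} P? f i = begin
    length (filter P? (reverse (take (toℕ i) (tabulate f)))) ≡⟨ ↭-length (filter-↭ P? (↭-reverse (take (toℕ i) (tabulate f)))) ⟩
    length (filter P? (take (toℕ i) (tabulate f)))           ≡⟨ cong (length ∘ filter P? ∘ take (toℕ i)) (List.map-tabulate id f) ⟨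
    length (filter P? (take (toℕ i) (map f (allFin m))))     ≡⟨ cong (length ∘ filter P?) (List.take-map (toℕ i) (allFin m)) ⟩
    length (filter P? (map f (take (toℕ i) (allFin m))))     ≡⟨ filter-map-length P? f (take (toℕ i) (allFin m)) ⟩
    length (filter (P? ∘ f) (take (toℕ i) (allFin m)))       ∎
    where open ≡-Reasoning

-- Deciding colourability and counting colours.

∃-vec? : ∀ {k} m {P : Vec (Fin k) m → Set} → Decidable P → Dec (∃ P)
∃-vec? zero    P? = map′ ([] ,_) (λ { ([] , p) → p }) (P? [])
∃-vec? (suc m) P? = map′ (λ (x , xs , p) → x ∷ xs , p) (λ { (x ∷ xs , p) → x , xs , p })
  (Fin.any? λ x → ∃-vec? m (P? ∘ (x ∷_)))

shareEndpoint? : ∀ e f → Dec (ShareEndpoint e f)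
shareEndpoint? e f = map′ find (λ (_ , x∈e , x∈f) → lose x∈e x∈f) (any? (_∈? endpoints f) (endpoints e))
  where open DecMembership ℕ._≟_ using (_∈?_)

module _ (es : List Edge) where

  private m = length es

  -- Colourings are vectors over a finite set, so that exhaustive search decides their existence and
  -- a least number of colours can be found.
  Colourable : ℕ → Set
  Colourable k = ∃ λ (c : Vec (Fin k) m) →
    ∀ i j → i ≢ j → ShareEndpoint (lookup es i) (lookup es j) → Vec.lookup c i ≢ Vec.lookup c j

  colourable? : Decidable Colourable
  colourable? k = ∃-vec? m λ c → Fin.all? λ i → Fin.all? λ j →
    ¬? (i Fin.≟ j) →-dec shareEndpoint? (lookup es i) (lookup es j) →-dec ¬? (Vec.lookup c i Fin.≟ Vec.lookup c j)

  Fin⇒Colourable : ∀ {k} (c : Fin m → Fin k) →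
    (∀ i j → i ≢ j → ShareEndpoint (lookup es i) (lookup es j) → c i ≢ c j) → Colourable k
  Fin⇒Colourable c proper = Vec.tabulate c , λ i j i≢j share eq → proper i j i≢j share
    (trans (sym (Vec.lookup∘tabulate c i)) (trans eq (Vec.lookup∘tabulate c j)))

  -- Each colour is replaced by its index in the list of distinct colours in use.
  proper⇒colourable : ∀ c → ProperColoring es c → Colourable (numColors es c)
  proper⇒colourable c proper = Fin⇒Colourable (index ∘ pos) λ i j i≢j share eq → proper i j i≢j share
    (trans (lookup-index (pos i)) (trans (cong (lookup (deduplicate ℕ._≟_ (tabulate c))) eq) (sym (lookup-index (pos j)))))
    where
    pos : ∀ i → c i ∈ deduplicate ℕ._≟_ (tabulate c)
    pos i = ∈-deduplicate⁺ ℕ._≟_ (∈-tabulate⁺ i)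

  numColors-≤ : ∀ c palette → (∀ i → c i ∈ palette) → numColors es c ≤ length palette
  numColors-≤ c palette c∈ = unique-⊆-length (deduplicate-! ℕ._≟_ (tabulate c)) λ x∈ →
    in-palette (∈-tabulate⁻ (∈-deduplicate⁻ ℕ._≟_ (tabulate c) x∈))
    where
    in-palette : ∀ {x} → (∃ λ i → x ≡ c i) → x ∈ palette
    in-palette (i , refl) = c∈ i

-- Orienting the edges along the degeneracy order.

module Orientation {d : ℕ} (es : List Edge) (simple : IsSimple es) (degenerate : Degenerate d es) where

  vs : List Vertex
  vs = proj₁ degenerate

  n m : ℕ
  n = length vs
  m = length es

  at : Fin n → Vertex
  at = lookup vs

  at-injective : ∀ {u x} → at u ≡ at x → u ≡ x
  at-injective = lookup-injective (proj₁ (proj₂ degenerate)) _ _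

  record Oriented (e : Edge) : Set where
    field
      side         : Bool
      parent child : Fin n
      ordered      : parent Fin.< child
      parent-≡     : parentOf e side ≡ at parent
      child-≡      : parentOf e (not side) ≡ at child

  open Oriented

  orient : ∀ e → proj₁ e ≢ proj₂ e → All (_∈ vs) (endpoints e) → Oriented e
  orient (u , v) u≢v (u∈ ∷ v∈ ∷ []) with Fin.<-cmp (index u∈) (index v∈)
  ... | tri< u<v _ _ = record { side = true ; ordered = u<v ; parent-≡ = lookup-index u∈ ; child-≡ = lookup-index v∈ }
  ... | tri> _ _ v<u = record { side = false ; ordered = v<u ; parent-≡ = lookup-index v∈ ; child-≡ = lookup-index u∈ }
  ... | tri≈ _ eq _  = contradiction (trans (lookup-index u∈) (trans (cong at eq) (sym (lookup-index v∈)))) u≢v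

  arc : ∀ i → Oriented (lookup es i)
  arc i = orient (lookup es i) (proj₁ simple i) (proj₁ (proj₂ (proj₂ degenerate)) (lookup es i) (∈-lookup i))

  par chi : Fin m → Fin n
  par = parent ∘ arc
  chi = child ∘ arc

  sameEdge : ∀ {e u v} (o : Oriented e) → at (parent o) ≡ u → at (child o) ≡ v → SameEdge e (u , v)
  sameEdge record { side = true  ; parent-≡ = p ; child-≡ = c } refl refl = inj₁ (p , c)
  sameEdge record { side = false ; parent-≡ = p ; child-≡ = c } refl refl = inj₂ (c , p)

  sameEdge-trans : ∀ {e f g} → SameEdge e g → SameEdge f g → SameEdge e f
  sameEdge-trans (inj₁ (refl , refl)) (inj₁ (refl , refl)) = inj₁ (refl , refl)
  sameEdge-trans (inj₁ (refl , refl)) (inj₂ (refl , refl)) = inj₂ (refl , refl)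
  sameEdge-trans (inj₂ (refl , refl)) (inj₁ (refl , refl)) = inj₂ (refl , refl)
  sameEdge-trans (inj₂ (refl , refl)) (inj₂ (refl , refl)) = inj₁ (refl , refl)

  par-chi-injective : ∀ {i j} → par i ≡ par j → chi i ≡ chi j → i ≡ j
  par-chi-injective {i} {j} pi≡pj ci≡cj = proj₂ simple i j
    (sameEdge-trans (sameEdge (arc i) (cong at pi≡pj) (cong at ci≡cj)) (sameEdge (arc j) refl refl))

  earlierNeighbours : Fin n → List Vertex
  earlierNeighbours k = filter (λ u → adj? es u (lookup vs k)) (take (toℕ k) vs)

  par∈ : ∀ i → at (par i) ∈ earlierNeighbours (chi i)
  par∈ i = ∈-filter⁺ (λ u → adj? es u (at (chi i)))
    (subst (λ xs → at (par i) ∈ take (toℕ (chi i)) xs) (List.tabulate-lookup vs)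
           (∈-take-tabulate⁺ at (toℕ (chi i)) (ordered (arc i))))
    (lose (∈-lookup i) (sameEdge (arc i) refl refl))

  neighbourLabel : ∀ k {u} → u ∈ earlierNeighbours k → Fin d
  neighbourLabel k u∈ = Fin.inject≤ (index u∈) (proj₂ (proj₂ (proj₂ degenerate)) k)

  -- The equation `k ≡ k′` is a separate argument because it is applied to `chi i` and `chi j`,
  -- which are not variables that could be matched.
  neighbourLabel-injective : ∀ {k k′ u v} → k ≡ k′ → (u∈ : u ∈ earlierNeighbours k) (v∈ : v ∈ earlierNeighbours k′) →
                             neighbourLabel k u∈ ≡ neighbourLabel k′ v∈ → u ≡ v
  neighbourLabel-injective {k} refl u∈ v∈ eq = trans (lookup-index u∈)
    (trans (cong (lookup (earlierNeighbours k)) (Fin.inject≤-injective bound bound _ _ eq)) (sym (lookup-index v∈)))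
    where bound = proj₂ (proj₂ (proj₂ degenerate)) k

  inLabel : Fin m → Fin d
  inLabel i = neighbourLabel (chi i) (par∈ i)

  inLabel-injective : ∀ {i j} → chi i ≡ chi j → inLabel i ≡ inLabel j → i ≡ j
  inLabel-injective {i} {j} ci≡cj eq =
    par-chi-injective (at-injective (neighbourLabel-injective ci≡cj (par∈ i) (par∈ j) eq)) ci≡cj

  incident⁺ : ∀ {e x} (o : Oriented e) → x ∈ endpoints e → ∃ λ u → at u ≡ x × (parent o ≡ u ⊎ child o ≡ u)
  incident⁺ record { side = true  ; parent-≡ = p } (here refl)         = _ , sym p , inj₁ refl
  incident⁺ record { side = true  ; child-≡ = c }  (there (here refl)) = _ , sym c , inj₂ refl
  incident⁺ record { side = false ; child-≡ = c }  (here refl)         = _ , sym c , inj₂ refl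
  incident⁺ record { side = false ; parent-≡ = p } (there (here refl)) = _ , sym p , inj₁ refl

  incident⁻ : ∀ {e u} (o : Oriented e) → parent o ≡ u ⊎ child o ≡ u → at u ∈ endpoints e
  incident⁻ record { side = true  ; parent-≡ = p } (inj₁ refl) = here (sym p)
  incident⁻ record { side = true  ; child-≡ = c }  (inj₂ refl) = there (here (sym c))
  incident⁻ record { side = false ; child-≡ = c }  (inj₂ refl) = here (sym c)
  incident⁻ record { side = false ; parent-≡ = p } (inj₁ refl) = there (here (sym p))

  Incident : Fin n → Fin m → Set
  Incident u i = par i ≡ u ⊎ chi i ≡ u

  share⇒incident : ∀ {i j} → ShareEndpoint (lookup es i) (lookup es j) → ∃ λ u → Incident u i × Incident u j
  share⇒incident {i} {j} (x , x∈i , x∈j)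
    with u , at-u , ui ← incident⁺ (arc i) x∈i
       | v , at-v , vj ← incident⁺ (arc j) x∈j
    with refl ← at-injective {u} {v} (trans at-u (sym at-v)) = u , ui , vj

  incident⇒share : ∀ {u i j} → Incident u i → Incident u j → ShareEndpoint (lookup es i) (lookup es j)
  incident⇒share {u} {i} {j} ui uj = at u , incident⁻ (arc i) ui , incident⁻ (arc j) uj

-- Correctness and optimality of the algorithm.

Fin≡1-prop : ∀ {b} → b ≡ 1 → (x y : Fin b) → x ≡ y
Fin≡1-prop refl zero zero = refl

module Correctness {d l : ℕ} (b : ℕ) .{{_ : NonZero b}} (d≤b : d ≤ b) (large : d + d ≤ b ⊎ b ≡ 1)
  (3≤l : 3 ≤ l) (b≤2^l∸3 : b ≤ 2 ^ (l ∸ 3))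
  (es : List Edge) (simple : IsSimple es) (degenerate : Degenerate d es) where

  open Orientation es simple degenerate

  abstract
    optimum : ∃ λ k → Colourable es k × (∀ {j} → j < k → ¬ Colourable es j)
    -- Giving every edge its own colour shows that the search succeeds by `m`.
    optimum = least (colourable? es) {m} (Fin⇒Colourable es id λ i j i≢j _ → i≢j)

  k q r : ℕ
  k = proj₁ optimum
  q = k / b
  r = k % b

  k≡ : k ≡ r + q * b
  k≡ = m≡m%n+[m/n]*n k b

  opt : Fin m → Fin k
  opt = Vec.lookup (proj₁ (proj₁ (proj₂ optimum)))

  opt-proper : ∀ {u i j} → Incident u i → Incident u j → opt i ≡ opt j → i ≡ j
  opt-proper {u} {i} {j} ui uj eq with i Fin.≟ j
  ... | yes i≡j = i≡j
  ... | no i≢j  = contradiction eq (proj₂ (proj₁ (proj₂ optimum)) i j i≢j (incident⇒share ui uj))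

  -- The edges that are not extra. The optimal colouring uses at most `k ∸ r = q * b` colours on
  -- them, hence the `q` classes.
  Sel : Fin m → Set
  Sel i = r ≤ toℕ (opt i)

  Sel? : Decidable Sel
  Sel? i = r ℕ.≤? toℕ (opt i)

  open Blocks b d≤b par chi (λ i → Oriented.ordered (arc i)) inLabel inLabel-injective Sel?
    hiding (Incident)

  class<q : ∀ {i} → Sel i → class i < q
  class<q = class-< q (trans (cong (_∸ r) k≡) (ℕ.m+n∸m≡n r (q * b))) base λ si sj ui uj eq →
    opt-proper ui uj (Fin.toℕ-injective (trans (sym (ℕ.m+[n∸m]≡n si)) (trans (cong (r +_)
      (Fin.fromℕ<-injective _ _ _ _ eq)) (ℕ.m+[n∸m]≡n sj))))
    where
    base : ∀ {i} → Sel i → Fin (k ∸ r)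
    base {i} si = fromℕ< {toℕ (opt i) ∸ r} (ℕ.∸-monoˡ-< (Fin.toℕ<n (opt i)) si)

  InClass : ℕ → Fin m → Set
  InClass κ i = Sel i × class i ≡ κ

  ClassColouring : ℕ → Set
  ClassColouring κ = Σ (∀ {i} → InClass κ i → Fin b) λ colour →
    ∀ {u i j} (Pi : InClass κ i) (Pj : InClass κ j) → Incident u i → Incident u j → colour Pi ≡ colour Pj → i ≡ j

  class-colourable : ∀ κ → ClassColouring κ
  class-colourable κ = cases large
    where
    cases : d + d ≤ b ⊎ b ≡ 1 → ClassColouring κ
    cases (inj₁ 2d≤b) = edges-colourable 2d≤b (λ i → Oriented.ordered (arc i)) par-chi-injective inLabel inLabel-injective
      (λ i → Sel? i ×-dec (class i ℕ.≟ κ)) (λ {u} {i} → blockLabel {u} {i})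
      (λ ui uj (si , ci) (sj , cj) → blockLabel-injective ui uj si sj (trans ci (sym cj)))
    -- Here a class is a matching: all block labels coincide, so incident edges of one class are
    -- equal. The label is chosen only as an element of `Fin b`.
    cases (inj₂ b≡1) = (λ {i} _ → blockLabel {par i} (inj₁ refl)) , λ (si , ci) (sj , cj) ui uj _ →
      blockLabel-injective ui uj si sj (trans ci (sym cj)) (Fin≡1-prop b≡1 _ _)

  colourIn : ∀ κ {i} → InClass κ i → Fin b
  colourIn κ = proj₁ (class-colourable κ)

  colourIn-proper : ∀ {κ κ′ u i j} → κ ≡ κ′ → (Pi : InClass κ i) (Pj : InClass κ′ j) →
    Incident u i → Incident u j → colourIn κ Pi ≡ colourIn κ′ Pj → i ≡ j
  colourIn-proper {κ} refl = proj₂ (class-colourable κ)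

  inBlock : ∀ {i} → Sel i → ℕ
  inBlock {i} si = toℕ (colourIn (class i) (si , refl))

  inBlock<b : ∀ {i} (si : Sel i) → inBlock si < b
  inBlock<b {i} si = Fin.toℕ<n (colourIn (class i) (si , refl))

  side : Fin m → Bool
  side = Oriented.side ∘ arc

  shift : Fin m → Bool
  shift = proj₁ ∘ class-shift

  advice : Fin m → Advice
  advice i with Sel? i
  ... | yes si = false , side i , shift i , inBlock si
  ... | no _   = true , side i , shift i , toℕ (opt i)

  encode : ∀ i → ∃ λ (v : Vec Bool l) → decode (Vec.toList v) ≡ advice i
  encode i with Sel? i
  ... | yes si = decode-surjective 3≤l false (side i) (shift i) (ℕ.<-≤-trans (inBlock<b si) b≤2^l∸3)
  ... | no ¬si = decode-surjective 3≤l true (side i) (shift i)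
    (ℕ.<-≤-trans (ℕ.<-trans (ℕ.≰⇒> ¬si) (m%n<n k b)) b≤2^l∸3)

  bits : List (Vec Bool l)
  bits = tabulate (proj₁ ∘ encode)

  colour : Fin m → ℕ
  colour i with Sel? i
  ... | yes si = b + (inBlock si + class i * b)
  ... | no _   = toℕ (opt i)

  entry : Fin m → Edge × Advice
  entry i = lookup es i , advice i

  counted⇔ : ∀ u i → (Counted (at u) (entry i) → Sel i × par i ≡ u) × (Sel i × par i ≡ u → Counted (at u) (entry i))
  counted⇔ u i with Sel? i
  ... | yes si = (λ (_ , eq) → si , at-injective (trans (sym (Oriented.parent-≡ (arc i))) eq))
               , λ (_ , eq) → refl , trans (Oriented.parent-≡ (arc i)) (cong at eq)
  ... | no ¬si = (λ { (() , _) }) , λ (si , _) → contradiction si ¬si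

  count-≡ : ∀ i → length (filter (counted? (at (par i))) (reverse (take (toℕ i) (tabulate entry)))) ≡ rank i
  count-≡ i = trans (count-before (counted? (at (par i))) entry i)
    (cong length (List.filter-≐ (counted? (at (par i)) ∘ entry) (λ j → Sel? j ×-dec (par j Fin.≟ par i))
      ((λ {j} → proj₁ (counted⇔ (par i) j)) , (λ {j} → proj₂ (counted⇔ (par i) j))) (take (toℕ i) (allFin m))))

  nextColour-≡ : ∀ i → nextColour b (entry i ∷ reverse (take (toℕ i) (tabulate entry))) ≡ colour i
  nextColour-≡ i with Sel? i | count-≡ i
  ... | no _   | _     = refl
  ... | yes si | count = cong (λ x → b + (inBlock si + x * b)) (begin
    length (filter (counted? (parentOf (lookup es i) (side i))) past) / b + (if shift i then 1 else 0)
      ≡⟨ cong (λ u → length (filter (counted? u) past) / b + (if shift i then 1 else 0)) (Oriented.parent-≡ (arc i)) ⟩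
    length (filter (counted? (at (par i))) past) / b + (if shift i then 1 else 0)
      ≡⟨ cong (λ x → x / b + (if shift i then 1 else 0)) count ⟩
    rank i / b + (if shift i then 1 else 0)
      ≡⟨ proj₂ (class-shift i) ⟨
    class i ∎)
    where
    open ≡-Reasoning
    past = reverse (take (toℕ i) (tabulate entry))

  run-≡ : ∀ i → run (online b) es bits i ≡ colour i
  run-≡ i = begin
    run (online b) es bits i
      ≡⟨ cong (λ xs → nextColour b (reverse (zip (take (suc (toℕ i)) xs) (map (decode ∘ Vec.toList) (take (suc (toℕ i)) bits)))))
              (List.tabulate-lookup es) ⟨
    nextColour b (reverse (zip (take (suc (toℕ i)) (tabulate (lookup es))) (map (decode ∘ Vec.toList) (take (suc (toℕ i)) bits))))
      ≡⟨ cong (nextColour b ∘ reverse) (zip-take-tabulate (decode ∘ Vec.toList) (lookup es) (proj₁ ∘ encode) (suc (toℕ i))) ⟩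
    nextColour b (reverse (take (suc (toℕ i)) (tabulate λ j → lookup es j , decode (Vec.toList (proj₁ (encode j))))))
      ≡⟨ cong (nextColour b ∘ reverse ∘ take (suc (toℕ i))) (List.tabulate-cong λ j → cong (lookup es j ,_) (proj₂ (encode j))) ⟩
    nextColour b (reverse (take (suc (toℕ i)) (tabulate entry)))
      ≡⟨ cong (nextColour b) (reverse-take-suc entry i) ⟩
    nextColour b (entry i ∷ reverse (take (toℕ i) (tabulate entry)))
      ≡⟨ nextColour-≡ i ⟩
    colour i ∎
    where open ≡-Reasoning

  block-≡ : ∀ {x y c c′} → x < b → y < b → x + c * b ≡ y + c′ * b → x ≡ y × c ≡ c′
  block-≡ {x} {y} {c} {c′} x<b y<b eq = x≡y , ℕ.*-cancelʳ-≡ c c′ b (ℕ.+-cancelˡ-≡ x _ _ (trans eq (cong (_+ c′ * b) (sym x≡y))))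
    where
    x≡y : x ≡ y
    x≡y = begin
      x               ≡⟨ m<n⇒m%n≡m x<b ⟨
      x % b           ≡⟨ [m+kn]%n≡m%n x c b ⟨
      (x + c * b) % b ≡⟨ cong (_% b) eq ⟩
      (y + c′ * b) % b ≡⟨ [m+kn]%n≡m%n y c′ b ⟩
      y % b           ≡⟨ m<n⇒m%n≡m y<b ⟩
      y               ∎
      where open ≡-Reasoning

  opt<b : ∀ {i} → ¬ Sel i → toℕ (opt i) < b
  opt<b ¬si = ℕ.<-trans (ℕ.≰⇒> ¬si) (m%n<n k b)

  -- Extra edges stay below `b` and all others do not. Between two others, equal colours force equal
  -- classes and equal colours within the class, by uniqueness of division with remainder.
  colour-proper : ∀ {u i j} → Incident u i → Incident u j → colour i ≡ colour j → i ≡ j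
  colour-proper {u} {i} {j} ui uj eq with Sel? i | Sel? j
  ... | no _   | no _   = opt-proper ui uj (Fin.toℕ-injective eq)
  ... | no ¬si | yes _  = contradiction eq (ℕ.<⇒≢ (ℕ.<-≤-trans (opt<b ¬si) (ℕ.m≤m+n b _)))
  ... | yes _  | no ¬sj = contradiction (sym eq) (ℕ.<⇒≢ (ℕ.<-≤-trans (opt<b ¬sj) (ℕ.m≤m+n b _)))
  ... | yes si | yes sj
    with ins , cls ← block-≡ {c = class i} {class j} (inBlock<b si) (inBlock<b sj) (ℕ.+-cancelˡ-≡ b _ _ eq) =
    colourIn-proper cls (si , refl) (sj , refl) ui uj (Fin.toℕ-injective ins)

  run-proper : ProperColoring es (run (online b) es bits)
  run-proper i j i≢j share eq with u , ui , uj ← share⇒incident {i} {j} share =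
    i≢j (colour-proper ui uj (trans (sym (run-≡ i)) (trans eq (run-≡ j))))

  -- The gap between `r` and `b` contributes no colours, so `r + q * b` remain, which is the
  -- optimum.
  palette : List ℕ
  palette = upTo r ++ map (b +_) (upTo (q * b))

  palette-length : length palette ≡ k
  palette-length = trans (List.length-++ (upTo r)) (trans (cong₂ _+_ (List.length-upTo r)
    (trans (List.length-map (b +_) (upTo (q * b))) (List.length-upTo (q * b)))) (sym k≡))

  colour∈palette : ∀ i → colour i ∈ palette
  colour∈palette i with Sel? i
  ... | no ¬si = ∈-++⁺ˡ (∈-upTo⁺ (ℕ.≰⇒> ¬si))
  ... | yes si = ∈-++⁺ʳ (upTo r) (∈-map⁺ (b +_) (∈-upTo⁺
    (ℕ.<-≤-trans (ℕ.+-monoˡ-< (class i * b) (inBlock<b si)) (ℕ.*-monoˡ-≤ b (class<q si)))))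

  run-optimal : ∀ c → ProperColoring es c → numColors es (run (online b) es bits) ≤ numColors es c
  run-optimal c c-proper = begin
    numColors es (run (online b) es bits) ≤⟨ numColors-≤ es (run (online b) es bits) palette
                                               (λ i → subst (_∈ palette) (sym (run-≡ i)) (colour∈palette i)) ⟩
    length palette                        ≡⟨ palette-length ⟩
    k                                     ≤⟨ ℕ.≮⇒≥ (λ lt → proj₂ (proj₂ optimum) lt (proper⇒colourable es c c-proper)) ⟩
    numColors es c                        ∎
    where open ℕ.≤-Reasoning

theorem2 : (d : ℕ) → 1 ≤ d →
    Σ (OnlineAlgorithm (adviceBits d)) λ A →
    (es : List Edge) → IsSimple es → Degenerate d es →
    Σ (List (Vec Bool (adviceBits d))) λ bs →
    length bs ≡ length es ×
    ProperColoring es (run A es bs) ×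
    IsChromaticIndex es (numColors es (run A es bs))
theorem2 d 1≤d with b , b≢0 , d≤b , large , 3≤l , b≤ ← blockSize d 1≤d =
  online b {{b≢0}} , λ es simple degenerate →
    let open Correctness b {{b≢0}} d≤b large 3≤l b≤ es simple degenerate in
    bits , List.length-tabulate _ , run-proper , (run (online b {{b≢0}}) es bits , run-proper , refl) , run-optimal
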